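{- Let $r\geq 2$. Then there exists a constant $c_r$ such that for every $n$, the number of $r$-uniform hypergraphs on a fixed set of $n$ vertices having girth at least $5$ is at most $2^{c_r n^{3/2}}$.
   Context: Hypergraphs are simple (no repeated edges). $C_2$ denotes the graph consisting of two parallel edges between two vertices, and $C_k$ ($k\ge 3$) the cycle of length $k$. For a graph $F$, a hypergraph $H$ is a Berge-$F$ if there is a bijection $f : E(F) \to E(H)$ with $e \subseteq f(e)$ for every $e \in E(F)$. An $r$-uniform hypergraph has girth at least $5$ if it contains no subhypergraph that is a Berge-$C_k$ for any $k\in\{2,3,4\}$ (in particular any two edges share at most one vertex). -}

module Defs where

open import Data.Bool.Base using (Bool; T)
open import Data.Fin.Base using (Fin; toℕ)
open import Data.Fin.Subset using (Subset; _∈_; ∣_∣)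
open import Data.Nat.Base using (ℕ; suc; _*_; _^_; _≤_; NonZero)
open import Data.Nat.DivMod using (_mod_)
open import Data.Product.Base using (Σ-syntax; ∃-syntax; _×_; _,_; proj₁; proj₂)
open import Function.Bundles using (Bijection; _↣_; _⤖_; module Injection; module Bijection)
open import Level using (0ℓ)
open import Relation.Binary.Bundles using (Setoid)
open import Relation.Binary.PropositionalEquality using (_≡_; setoid; _→-setoid_)
import Relation.Binary.Construct.On as On
open import Relation.Nullary.Negation using (¬_)

-- A hypergraph on the vertex set Fin n is its set of edges, given by a
-- characteristic function; in particular there are no repeated edges.
Hypergraph : ℕ → Set
Hypergraph n = Subset n → Bool

Edge : ∀ {n} → Hypergraph n → Set
Edge {n} H = Σ[ e ∈ Subset n ] T (H e)

_⊑_ : ∀ {n} → Hypergraph n → Hypergraph n → Set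
H′ ⊑ H = ∀ e → T (H′ e) → T (H e)

Uniform : ℕ → ∀ {n} → Hypergraph n → Set
Uniform r H = ∀ e → T (H e) → ∣ e ∣ ≡ r

-- Edges are labelled, so that parallel edges are possible. The order in
-- which the two ends of an edge are listed is immaterial.
record Multigraph : Set where
  field
    order : ℕ
    size  : ℕ
    ends  : Fin size → Fin order × Fin order

-- The i-th edge joins i to i + 1 modulo k; cycle 2 consists of two
-- parallel edges. Only used for k ≥ 2.
cycle : (k : ℕ) → .{{NonZero k}} → Multigraph
cycle k = record
  { order = k
  ; size  = k
  ; ends  = λ i → i , suc (toℕ i) mod k
  }

-- The injection φ places a copy of F on the vertices of H. The bijection is
-- between the edge sets, and each edge of the copy is contained in its image.
IsBerge : Multigraph → ∀ {n} → Hypergraph n → Set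
IsBerge F {n} H =
  Σ[ φ ∈ (Fin order ↣ Fin n) ]
  Σ[ f ∈ (Fin size ⤖ Edge H) ]
    (∀ e → Injection.to φ (proj₁ (ends e)) ∈ proj₁ (Bijection.to f e)
         × Injection.to φ (proj₂ (ends e)) ∈ proj₁ (Bijection.to f e))
  where open Multigraph F

ContainsBerge : Multigraph → ∀ {n} → Hypergraph n → Set
ContainsBerge F H = ∃[ H′ ] H′ ⊑ H × IsBerge F H′

Girth≥5 : ∀ {n} → Hypergraph n → Set
Girth≥5 H = ¬ ContainsBerge (cycle 2) H
          × ¬ ContainsBerge (cycle 3) H
          × ¬ ContainsBerge (cycle 4) H

-- Two hypergraphs are equal when they have the same edges, i.e. when their
-- characteristic functions agree pointwise.
Girth≥5Hypergraphs : (r n : ℕ) → Setoid 0ℓ 0ℓ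
Girth≥5Hypergraphs r n =
  On.setoid {B = Σ[ H ∈ Hypergraph n ] Uniform r H × Girth≥5 H}
            (Subset n →-setoid Bool) proj₁

HasCardinality : Setoid 0ℓ 0ℓ → ℕ → Set
HasCardinality S N = Bijection (setoid (Fin N)) S

-- N ≤ 2 ^ (c n^(3/2)) for the real power: N ≤ 2 ^ x holds iff
-- N ≤ 2 ^ (p / q), i.e. N ^ q ≤ 2 ^ p, for every rational p / q ≥ x, and
-- p / q ≥ c n^(3/2) means c² n³ q² ≤ p².
_≤2^[_·_^3/2] : (N c n : ℕ) → Set
N ≤2^[ c · n ^3/2] =
  ∀ p q → .{{NonZero q}} → c ^ 2 * n ^ 3 * q ^ 2 ≤ p ^ 2 → N ^ q ≤ 2 ^ p

{-# OPTIONS --safe #-}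

-- For a hypergraph H of girth at least 5 and positions i, j, join in each edge of H its i-th
-- and j-th vertices. The resulting graph has no 4-cycle, since a 4-cycle would use four
-- distinct edges of H, and these r² graphs determine H, since H has no Berge triangle. So it
-- is enough to bound the number of C₄-free graphs on n vertices by 2^(O(n^(3/2))), as Kleitman
-- and Winston did. Delete a vertex of minimum degree d: its neighbourhood is independent in
-- the graph joining two remaining vertices with a common neighbour. As the remaining degrees
-- are at least d − 1, that graph is dense on every vertex set with many more than n / d
-- elements, so branching on a vertex of high degree shrinks the candidate set quickly, and
-- there are only 2^(O(√n)) possible neighbourhoods.
module Submission where

open import Defs
import Algebra.Properties.Semiring.Sum as SemiringSum
open import Data.Bool.Base using (Bool; true; false; T; not; _∧_; _∨_)
open import Data.Bool.Properties as Bool using (T-∧; T?; T-not-≡)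
open import Data.Empty using (⊥; ⊥-elim)
open import Data.Fin.Base as Fin using (Fin; zero; suc; toℕ; punchIn; punchOut)
open import Data.Fin.Properties as Fin using (_≟_)
open import Data.Fin.Subset using (Subset; _∈_; ∣_∣; _⊆_)
open import Data.Fin.Subset.Properties using (_∈?_; anySubset?; ⊆-antisym; p⊂q⇒∣p∣<∣q∣)
open import Data.List.Base
  using (List; []; _∷_; [_]; length; _++_; concatMap; map; allFin; lookup; deduplicate)
open import Data.List.Membership.Propositional.Properties using (∈-lookup)
open import Data.List.Properties using (length-++; length-map; length-tabulate; length-deduplicate)
import Data.List.Relation.Unary.All as All
open import Data.List.Relation.Unary.AllPairs using (AllPairs; []; _∷_)
open import Data.List.Relation.Unary.Any as Any using (Any; here; there)
import Data.List.Relation.Unary.Any.Properties as Any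
import Data.List.Relation.Unary.Unique.DecSetoid.Properties as UniqueDec
open import Data.Nat.Base
  using (ℕ; zero; suc; _+_; _*_; _^_; _≤_; _<_; z≤n; s≤s; pred; NonZero; ≢-nonZero)
open import Data.Nat.DivMod using (_/_; m≡m%n+[m/n]*n; m%n<n; m/n*n≤m; m/n≤m)
open import Data.Nat.Properties as ℕ hiding (_≟_)
open import Data.Nat.Solver using (module +-*-Solver)
open import Data.Product.Base using (∃-syntax; Σ-syntax; ∃; _×_; _,_; proj₁; proj₂)
open import Data.Sum.Base using (_⊎_; inj₁; inj₂; [_,_]′)
open import Data.Unit.Base using (⊤; tt)
open import Data.Vec.Base as Vec using (Vec; []; _∷_; here; there; tabulate)
open import Data.Vec.Functional using (removeAt)
open import Data.Vec.Properties using (lookup∘tabulate; ≡-dec)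
open import Data.Vec.Relation.Unary.All using ([]; _∷_)
open import Data.Vec.Relation.Unary.AllPairs using ([]; _∷_)
open import Data.Vec.Relation.Unary.Unique.Propositional.Properties using (lookup-injective)
open import Function.Base using (_∘_; id; case_of_; _∋_)
open import Function.Bundles using (Bijection; Equivalence; Injection; mk↣; mk⤖)
open import Level using (0ℓ)
open import Relation.Binary.Bundles using (Setoid; DecSetoid)
open import Relation.Binary.PropositionalEquality
  using (_≡_; _≢_; refl; sym; trans; cong; cong₂; subst; subst₂; _≗_; module ≡-Reasoning)
open import Relation.Nullary.Decidable
  using (Dec; yes; no; does; _×-dec_; _→-dec_; _⊎-dec_; ¬?; map′; decidable-stable;
         toWitness; fromWitness; ⌊_⌋)
open import Relation.Nullary.Negation using (¬_; contradiction)

open SemiringSum +-*-semiring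
  using (sum; sum-remove; ∑-distrib-+; ∑-comm; sum-cong-≗; *-distribˡ-sum; *-distribʳ-sum)

-- Listing all sets of up to about √n vertices costs 2^(O(√n log n)) per deleted vertex, and this
-- logarithm would survive into the final bound; the branching exists to remove it. With s of order
-- √n and D = d - 1, it shrinks the candidate set to at most 2s² / D elements, and choosing up to D
-- + 1 of those costs only 2^(O(s)), because s / D ≤ 2^(s / D). The branching itself costs 2^(O(log⁴
-- n)), which s absorbs. When D log n is O(s), the crude list is already short enough. The lists are
-- built for graphs not known to be C₄-free, so the assumptions on the graph belong to the predicate
-- that a list has to cover. Where branching finds no vertex of high degree, that predicate is
-- empty, and so is the list.

private
  variable
    A C : Set
    b b₁ b₂ m n : ℕ

-- Covers of a class of objects by a short list

-- Only upper bounds matter until the end, so the list may contain repetitions and elements outside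
-- `P`.
record Cover (_≈_ : A → A → Set) (P : A → Set) (b : ℕ) : Set where
  field
    elements : List A
    bound    : length elements ≤ b
    covers   : ∀ {a} → P a → Any (_≈ a) elements

open Cover

module _ {_≈_ : A → A → Set} where

  cover-≤ : {P : A → Set} → b₁ ≤ b₂ → Cover _≈_ P b₁ → Cover _≈_ P b₂
  cover-≤ b₁≤b₂ K = record
    { elements = elements K ; bound = ≤-trans (bound K) b₁≤b₂ ; covers = covers K }

  cover-⊆ : {P Q : A → Set} → (∀ {a} → Q a → P a) → Cover _≈_ P b → Cover _≈_ Q b
  cover-⊆ Q⊆P K = record
    { elements = elements K ; bound = bound K ; covers = covers K ∘ Q⊆P }

  cover-empty : {P : A → Set} → (∀ {a} → ¬ P a) → Cover _≈_ P 0
  cover-empty ¬P = record { elements = [] ; bound = z≤n ; covers = ⊥-elim ∘ ¬P }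

  cover-singleton : {P : A → Set} (a : A) → (∀ {a′} → P a′ → a ≈ a′) → Cover _≈_ P 1
  cover-singleton a eq = record
    { elements = [ a ] ; bound = ≤-refl ; covers = here ∘ eq }

  cover-∪ : {P Q R : A → Set} → (∀ {a} → R a → P a ⊎ Q a) →
            Cover _≈_ P b₁ → Cover _≈_ Q b₂ → Cover _≈_ R (b₁ + b₂)
  cover-∪ {b₁} split K L = record
    { elements = elements K ++ elements L
    ; bound    = ≤-trans (≤-reflexive (length-++ (elements K))) (+-mono-≤ (bound K) (bound L))
    ; covers   = [ Any.++⁺ˡ ∘ covers K , Any.++⁺ʳ (elements K) ∘ covers L ]′ ∘ split
    }

  module _ {_∼_ : C → C → Set} where

    cover-map : {P : A → Set} {R : C → Set} (f : A → C) →
                (∀ {c} → R c → ∃[ a ] P a × (∀ {a′} → a′ ≈ a → f a′ ∼ c)) →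
                Cover _≈_ P b → Cover _∼_ R b
    cover-map f pre K = record
      { elements = map f (elements K)
      ; bound    = ≤-trans (≤-reflexive (length-map f (elements K))) (bound K)
      ; covers   = λ Rc → let _ , Pa , eq = pre Rc in Any.map⁺ (Any.map eq (covers K Pa))
      }

    -- An object is described in two stages: `a`, then the rest given `a`. The first list contains
    -- `a` only up to `_≈_`, so `Q` is demanded for every representative of `a`.
    cover-bind : {P : A → Set} {Q : A → C → Set} {R : C → Set} →
                 (∀ {c} → R c → ∃[ a ] P a × (∀ {a′} → a′ ≈ a → Q a′ c)) →
                 Cover _≈_ P b₁ → (∀ a → Cover _∼_ (Q a) b₂) → Cover _∼_ R (b₁ * b₂)
    cover-bind {b₂ = b₂} pre K L = record
      { elements = concatMap (elements ∘ L) (elements K)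
      ; bound    = ≤-trans (length-bound (elements K)) (*-monoˡ-≤ b₂ (bound K))
      ; covers   = λ Rc → let _ , Pa , Qc = pre Rc in
                   Any.concatMap⁺ (elements ∘ L)
                     (Any.map (λ {a′} a′≈a → covers (L a′) (Qc a′≈a)) (covers K Pa))
      }
      where
      length-bound : ∀ as → length (concatMap (elements ∘ L) as) ≤ length as * b₂
      length-bound []       = z≤n
      length-bound (a ∷ as) = ≤-trans (≤-reflexive (length-++ (elements (L a))))
                                      (+-mono-≤ (bound (L a)) (length-bound as))

cover-Fin : ∀ k → Cover {Fin k} _≡_ (λ _ → ⊤) k
cover-Fin k = record
  { elements = allFin k
  ; bound    = ≤-reflexive (length-tabulate id)
  ; covers   = λ {i} _ → Any.tabulate⁺ i refl
  }

cover-family : ∀ k {_≈_ : A → A → Set} {P : A → Set} → Cover _≈_ P b →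
               Cover {Fin k → A} (λ f g → ∀ i → f i ≈ g i) (λ f → ∀ i → P (f i)) (b ^ k)
cover-family zero    K = cover-singleton (λ ()) (λ _ ())
cover-family (suc k) {_≈_} K =
  cover-bind
    {Q = λ a f → (a ≈ f zero) × (∀ i → _)}
    (λ {f} Pf → f zero , Pf zero , (λ eq → eq , Pf ∘ suc))
    K
    (λ a → cover-map (λ { f zero → a ; f (suc i) → f i })
             (λ { {f} (eq , Pf) → f ∘ suc , Pf , λ { eqs zero → eq ; eqs (suc i) → eqs i } })
             (cover-family k K))

-- Subsets of a finite set

Sub : ℕ → Set
Sub m = Fin m → Bool

𝟙 : Bool → ℕ
𝟙 true  = 1
𝟙 false = 0

card : Sub m → ℕ
card X = sum (𝟙 ∘ X)

_⊆ᵇ_ : Sub m → Sub m → Set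
S ⊆ᵇ X = ∀ y → T (S y) → T (X y)

infixl 6 _∖_

_∖_ : Sub m → Fin m → Sub m
(X ∖ x) y = X y ∧ not (does (y ≟ x))

sum-mono : {f g : Fin m → ℕ} → (∀ i → f i ≤ g i) → sum f ≤ sum g
sum-mono {zero}  f≤g = z≤n
sum-mono {suc m} f≤g = +-mono-≤ (f≤g zero) (sum-mono (f≤g ∘ suc))

sum-const : ∀ m c → sum {m} (λ _ → c) ≡ m * c
sum-const zero    c = refl
sum-const (suc m) c = cong (c +_) (sum-const m c)

𝟙≤1 : ∀ b → 𝟙 b ≤ 1
𝟙≤1 true  = ≤-refl
𝟙≤1 false = z≤n

𝟙-mono : ∀ {a b} → (T a → T b) → 𝟙 a ≤ 𝟙 b
𝟙-mono {false}        _ = z≤n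
𝟙-mono {true} {true}  _ = ≤-refl
𝟙-mono {true} {false} f = ⊥-elim (f tt)

T⇒𝟙 : ∀ {b} → T b → 𝟙 b ≡ 1
T⇒𝟙 {true} _ = refl

card-mono : {S X : Sub m} → S ⊆ᵇ X → card S ≤ card X
card-mono S⊆X = sum-mono (λ y → 𝟙-mono (S⊆X y))

card-≤ : (X : Sub m) → card X ≤ m
card-≤ {m} X = ≤-trans (sum-mono (λ y → 𝟙≤1 (X y)))
  (≤-reflexive (trans (sum-const m 1) (*-identityʳ m)))

card-∖ : (X : Sub m) (x : Fin m) → T (X x) → card X ≡ suc (card (X ∖ x))
card-∖ {suc m} X x Xx = begin
  card X                                      ≡⟨ sum-remove {i = x} (𝟙 ∘ X) ⟩
  𝟙 (X x) + sum (removeAt (𝟙 ∘ X) x)          ≡⟨ cong₂ _+_ (T⇒𝟙 Xx) (sum-cong-≗ (cong 𝟙 ∘ keep)) ⟩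
  suc (sum (removeAt (𝟙 ∘ (X ∖ x)) x))        ≡⟨ cong (λ c → suc (c + rest)) drop ⟨
  suc (𝟙 ((X ∖ x) x) + rest)                  ≡⟨ cong suc (sum-remove {i = x} (𝟙 ∘ (X ∖ x))) ⟨
  suc (card (X ∖ x))                          ∎
  where
  open ≡-Reasoning
  rest : ℕ
  rest = sum (removeAt (𝟙 ∘ (X ∖ x)) x)
  keep : ∀ y → X (punchIn x y) ≡ (X ∖ x) (punchIn x y)
  keep y with punchIn x y ≟ x
  ... | yes eq = contradiction eq (Fin.punchInᵢ≢i x y)
  ... | no  _  = sym (Bool.∧-identityʳ _)
  drop : 𝟙 ((X ∖ x) x) ≡ 0
  drop with x ≟ x
  ... | yes _  = cong 𝟙 (Bool.∧-zeroʳ (X x))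
  ... | no x≢x = contradiction refl x≢x

∖-≢ : (X : Sub m) {x y : Fin m} → y ≢ x → (X ∖ x) y ≡ X y
∖-≢ X {x} {y} y≢x with y ≟ x
... | yes eq = contradiction eq y≢x
... | no  _  = Bool.∧-identityʳ _

∖-self : (X : Sub m) (x : Fin m) → (X ∖ x) x ≡ false
∖-self X x with x ≟ x
... | yes _  = Bool.∧-zeroʳ (X x)
... | no x≢x = contradiction refl x≢x

∖-⊆ : (X : Sub m) (x : Fin m) → (X ∖ x) ⊆ᵇ X
∖-⊆ X x y = proj₁ ∘ Equivalence.to T-∧

insert : Fin m → Sub m → Sub m
insert x S y = S y ∨ does (y ≟ x)

insert-∖ : {S S′ : Sub m} {x : Fin m} → T (S x) → S′ ≗ (S ∖ x) → insert x S′ ≗ S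
insert-∖ {S = S} {S′} {x} Sx eq y with y ≟ x
... | yes refl = trans (Bool.∨-zeroʳ (S′ x)) (sym (Equivalence.to Bool.T-≡ Sx))
... | no y≢x   = trans (Bool.∨-identityʳ (S′ y)) (trans (eq y) (∖-≢ S y≢x))

cover-branch : {P P₀ P₁ : Sub m → Set} (x : Fin m) →
               (∀ {S} → P S → ¬ T (S x) → P₀ S) → (∀ {S} → P S → T (S x) → P₁ (S ∖ x)) →
               Cover _≗_ P₀ b₁ → Cover _≗_ P₁ b₂ → Cover _≗_ P (b₁ + b₂)
cover-branch {P = P} {P₀} x out inn K₀ K₁ =
  cover-∪ {P = P₀} {Q = λ S → P S × T (S x)} split K₀
    (cover-map (insert x) (λ { {S} (PS , Sx) → S ∖ x , inn PS Sx , insert-∖ Sx }) K₁)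
  where
  split : ∀ {S} → P S → P₀ S ⊎ (P S × T (S x))
  split {S} PS with T? (S x)
  ... | yes Sx = inj₂ (PS , Sx)
  ... | no ¬Sx = inj₁ (out PS ¬Sx)

⊆-∖ : {S X : Sub m} {x : Fin m} → S ⊆ᵇ X → ¬ T (S x) → S ⊆ᵇ (X ∖ x)
⊆-∖ {X = X} S⊆X ¬Sx y Sy = subst T (sym (∖-≢ X λ { refl → ¬Sx Sy })) (S⊆X y Sy)

∖-mono : {S X : Sub m} {x : Fin m} → S ⊆ᵇ X → (S ∖ x) ⊆ᵇ (X ∖ x)
∖-mono {S = S} {x = x} S⊆X =
  ⊆-∖ (λ y → S⊆X y ∘ ∖-⊆ S x y) (subst T (∖-self S x))

-- The sum of the binomial coefficients (k choose i) over i ≤ d, by Pascal's rule.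
subsets : ℕ → ℕ → ℕ
subsets _       zero    = 1
subsets zero    (suc d) = 1
subsets (suc k) (suc d) = subsets k (suc d) + subsets k d

cover-subsets : ∀ k d (X : Sub m) → card X ≡ k →
                Cover _≗_ (λ S → S ⊆ᵇ X × card S ≤ d) (subsets k d)
cover-subsets k zero X _ = cover-singleton (λ _ → false) empty
  where
  empty : ∀ {S} → S ⊆ᵇ X × card S ≤ 0 → ∀ y → false ≡ S y
  empty {S} (_ , S≤0) y with S y in eq
  ... | false = refl
  ... | true  = contradiction
    (subst (_≤ 0) (card-∖ S y (subst T (sym eq) tt)) S≤0) λ ()
cover-subsets zero (suc d) X X≡0 = cover-singleton (λ _ → false) empty
  where
  empty : ∀ {S} → S ⊆ᵇ X × card S ≤ suc d → ∀ y → false ≡ S y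
  empty {S} (S⊆X , _) y with S y in eq
  ... | false = refl
  ... | true  = contradiction
    (trans (sym (card-∖ X y (S⊆X y (subst T (sym eq) tt)))) X≡0) λ ()
cover-subsets (suc k) (suc d) X X≡k with Fin.any? (T? ∘ X)
... | no ¬∃ = contradiction (trans (sym X≡k) (empty-card X ¬∃)) λ ()
  where
  empty-card : ∀ {m} (X : Sub m) → ¬ (∃[ x ] T (X x)) → card X ≡ 0
  empty-card {m} X ¬∃ = trans (sum-cong-≗ z) (trans (sum-const m 0) (*-zeroʳ m))
    where
    z : ∀ x → 𝟙 (X x) ≡ 0
    z x with X x in eq
    ... | false = refl
    ... | true  = contradiction (x , subst T (sym eq) tt) ¬∃
... | yes (x , Xx) =
  cover-branch x
    (λ { (S⊆X , S≤) ¬Sx → ⊆-∖ S⊆X ¬Sx , S≤ })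
    (λ { {S} (S⊆X , S≤) Sx → ∖-mono S⊆X , ≤-pred (subst (_≤ suc d) (card-∖ S x Sx) S≤) })
    (cover-subsets k (suc d) (X ∖ x) X∖x≡k)
    (cover-subsets k d (X ∖ x) X∖x≡k)
  where
  X∖x≡k : card (X ∖ x) ≡ k
  X∖x≡k = suc-injective (trans (sym (card-∖ X x Xx)) X≡k)

-- The graph container algorithm

degreeIn : (Fin m → Fin m → Bool) → Sub m → Fin m → ℕ
degreeIn R X x = card (λ y → X y ∧ R x y)

module Container
  (R : Fin m → Fin m → Bool)
  (Q : Sub m → Set)
  (Q-∖ : ∀ {S x} → Q S → Q (S ∖ x))
  (Q-independent : ∀ {S x y} → Q S → T (S x) → T (S y) → ¬ T (R x y))
  (D : ℕ)
  where

  In : Sub m → Sub m → Set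
  In X S = S ⊆ᵇ X × Q S

  -- Sizes are multiplied by `D` throughout, so that no threshold has to be divided by it.
  Dense : ℕ → ℕ → Set
  Dense τ δ = ∀ {S} → Q S → ∀ X → τ < card X * D → ∃[ x ] T (X x) × δ ≤ degreeIn R X x

  -- At most `j` branching vertices are accepted into the set; the power counts their choices, and
  -- `b` counts what is chosen after them.
  Bounded : ℕ → ℕ → ℕ → Set
  Bounded τ b j = ∀ X → card X * D ≤ τ → Cover _≗_ (In X) (b * suc (card X) ^ j)

  non-neighbours : Sub m → Fin m → Sub m
  non-neighbours X x y = (X ∖ x) y ∧ not (R x y)

  card-non-neighbours : ∀ X x → card (non-neighbours X x) + degreeIn R X x ≤ card X
  card-non-neighbours X x = ≤-trans
    (≤-reflexive (sym (∑-distrib-+ (𝟙 ∘ non-neighbours X x) (λ y → 𝟙 (X y ∧ R x y)))))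
    (sum-mono λ y → pointwise (X y) _ (R x y))
    where
    pointwise : ∀ a b c → 𝟙 ((a ∧ b) ∧ not c) + 𝟙 (a ∧ c) ≤ 𝟙 a
    pointwise true  true  true  = ≤-refl
    pointwise true  true  false = ≤-refl
    pointwise true  false true  = ≤-refl
    pointwise true  false false = z≤n
    pointwise false _     _     = z≤n

  -- Rejecting the branching vertex removes that vertex alone. Accepting it removes at least `δ`
  -- neighbours as well and lands below `τ` at once, so there is at most one acceptance per step,
  -- and it costs one factor |X| + 1.
  step : ∀ {τ δ b j} → Dense τ δ → Bounded τ b j → Bounded (τ + δ * D) b (suc j)
  step {τ} {δ} {b} {j} dense below X = go (card X) X refl
    where
    go : ∀ k X → card X ≡ k → card X * D ≤ τ + δ * D → Cover _≗_ (In X) (b * suc (card X) ^ suc j)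
    go k X X≡k X≤ with card X * D ≤? τ
    ... | yes X≤τ = cover-≤ (*-monoʳ-≤ b (m≤n*m (suc (card X) ^ j) (suc (card X)))) (below X X≤τ)
    ... | no X≰τ with Fin.any? (λ x → T? (X x) ×-dec (δ ≤? degreeIn R X x))
    -- A set in `In X` would make the graph dense and so provide the missing vertex.
    ...   | no ¬∃ = cover-≤ z≤n (cover-empty λ { (_ , QS) → ¬∃ (dense QS X (≰⇒> X≰τ)) })
    go zero    X X≡k X≤ | no _ | yes (x , Xx , _) =
      contradiction (trans (sym (card-∖ X x Xx)) X≡k) λ ()
    go (suc k) X X≡k X≤ | no _ | yes (x , Xx , δ≤) =
      cover-≤ total
        (cover-branch x
          (λ { (S⊆X , QS) ¬Sx → ⊆-∖ S⊆X ¬Sx , QS })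
          (λ { {S} (S⊆X , QS) Sx →
                 (λ y t → Equivalence.from T-∧
                    ( ∖-mono S⊆X y t
                    , Equivalence.from T-not-≡ (¬T⇒≡false (Q-independent QS Sx (∖-⊆ S x y t)))))
               , Q-∖ QS })
          (go k (X ∖ x) X∖x≡k (≤-trans (*-monoˡ-≤ D (card-mono {S = X ∖ x} {X} (∖-⊆ X x))) X≤))
          (below (non-neighbours X x) drop))
      where
      ¬T⇒≡false : ∀ {c} → ¬ T c → c ≡ false
      ¬T⇒≡false {false} _ = refl
      ¬T⇒≡false {true}  f = ⊥-elim (f tt)

      X∖x≡k : card (X ∖ x) ≡ k
      X∖x≡k = suc-injective (trans (sym (card-∖ X x Xx)) X≡k)

      drop : card (non-neighbours X x) * D ≤ τ
      drop = +-cancelʳ-≤ (δ * D) _ _ (begin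
        k″ * D + δ * D             ≡⟨ *-distribʳ-+ D k″ δ ⟨
        (k″ + δ) * D               ≤⟨ *-monoˡ-≤ D (+-monoʳ-≤ k″ δ≤) ⟩
        (k″ + degreeIn R X x) * D  ≤⟨ *-monoˡ-≤ D (card-non-neighbours X x) ⟩
        card X * D                 ≤⟨ X≤ ⟩
        τ + δ * D                  ∎)
        where
        open ≤-Reasoning
        k″ : ℕ
        k″ = card (non-neighbours X x)

      -- With |X| = k′ + 1, the rejecting and the accepting branch add up to (k′ + 1)^(j+1) + (k′ +
      -- 1)^j = (k′ + 2)(k′ + 1)^j.
      total : b * suc (card (X ∖ x)) ^ suc j + b * suc (card (non-neighbours X x)) ^ j
            ≤ b * suc (card X) ^ suc j
      total = begin
        b * suc k′ ^ suc j + b * suc (card (non-neighbours X x)) ^ j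
          ≤⟨ +-monoʳ-≤ (b * suc k′ ^ suc j) (*-monoʳ-≤ b (^-monoˡ-≤ j (s≤s
               (card-mono {S = non-neighbours X x} {X ∖ x} λ y → proj₁ ∘ Equivalence.to T-∧)))) ⟩
        b * suc k′ ^ suc j + b * suc k′ ^ j  ≡⟨ *-distribˡ-+ b (suc k′ ^ suc j) (suc k′ ^ j) ⟨
        b * (suc k′ ^ suc j + suc k′ ^ j)    ≡⟨ cong (b *_) (+-comm (suc k′ ^ suc j) (suc k′ ^ j)) ⟩
        b * (suc (suc k′) * suc k′ ^ j)      ≤⟨ *-monoʳ-≤ b (*-monoʳ-≤ (suc (suc k′)) (^-monoˡ-≤ j (n≤1+n (suc k′)))) ⟩
        b * suc (suc k′) ^ suc j             ≡⟨ cong (λ c → b * suc c ^ suc j) (card-∖ X x Xx) ⟨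
        b * suc (card X) ^ suc j             ∎
        where
        open ≤-Reasoning
        k′ : ℕ
        k′ = card (X ∖ x)

  steps : ∀ {τ δ b j} → (∀ {σ} → τ ≤ σ → Dense σ δ) → Bounded τ b j →
          ∀ h → Bounded (τ + h * (δ * D)) b (h + j)
  steps {τ} {δ} dense below zero X X≤ = below X (subst (card X * D ≤_) (+-identityʳ τ) X≤)
  steps {τ} {δ} {b} {j} dense below (suc h) X X≤ =
    step {b = b} {h + j} (dense (m≤m+n τ (h * (δ * D)))) (steps {b = b} {j} dense below h) X
      (≤-trans X≤ (≤-reflexive (trans (cong (τ +_) (+-comm (δ * D) _)) (sym (+-assoc τ _ _)))))

-- Density of the graph of paths of length two

sum-exchange : ∀ {m n} (u : Fin m → ℕ) (v : Fin n → ℕ) (w : Fin n → Fin m → ℕ) →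
               sum (λ a → u a * sum (λ x → v x * w x a)) ≡ sum (λ x → v x * sum (λ a → u a * w x a))
sum-exchange {m} {n} u v w = begin
  sum (λ a → u a * sum (λ x → v x * w x a))
    ≡⟨ sum-cong-≗ (λ a → *-distribˡ-sum (u a) (λ x → v x * w x a)) ⟩
  sum (λ a → sum (λ x → u a * (v x * w x a)))
    ≡⟨ ∑-comm (λ a x → u a * (v x * w x a)) ⟩
  sum (λ x → sum (λ a → u a * (v x * w x a)))
    ≡⟨ sum-cong-≗ (λ x → sum-cong-≗ λ a → swap (u a) (v x) (w x a)) ⟩
  sum (λ x → sum (λ a → v x * (u a * w x a)))
    ≡⟨ sum-cong-≗ (λ x → *-distribˡ-sum (v x) (λ a → u a * w x a)) ⟨
  sum (λ x → v x * sum (λ a → u a * w x a)) ∎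
  where
  open ≡-Reasoning
  swap : ∀ a b c → a * (b * c) ≡ b * (a * c)
  swap a b c = trans (sym (*-assoc a b c)) (trans (cong (_* c) (*-comm a b)) (*-assoc b a c))

sum-select : ∀ (x : Fin m) c → sum (λ y → 𝟙 (does (x ≟ y)) * c) ≤ c
sum-select {suc m} zero c = ≤-reflexive (trans
  (cong₂ _+_ (+-identityʳ c) (trans (sum-const m 0) (*-zeroʳ m))) (+-identityʳ c))
sum-select {suc m} (suc x) c = sum-select x c

sum-unique : (f : Fin m → Bool) → (∀ {i j} → T (f i) → T (f j) → i ≡ j) → sum (𝟙 ∘ f) ≤ 1
sum-unique {zero} f unique = z≤n
sum-unique {suc m} f unique with f zero in eq
... | false = sum-unique (f ∘ suc) (λ s t → Fin.suc-injective (unique s t))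
... | true  = s≤s (≤-reflexive (trans (sum-cong-≗ others) (trans (sum-const m 0) (*-zeroʳ m))))
  where
  others : ∀ i → 𝟙 (f (suc i)) ≡ 0
  others i with f (suc i) in eq′
  ... | false = refl
  ... | true with () ← unique {zero} {suc i} (subst T (sym eq) tt) (subst T (sym eq′) tt)

2ct≤t²+c² : ∀ c t → 2 * c * t ≤ t * t + c * c
2ct≤t²+c² c t with ≤-total c t
... | inj₁ c≤t with k , refl ← m≤n⇒∃[o]m+o≡n c≤t =
  m+n≤o⇒m≤o (2 * c * (c + k)) {k * k} (≤-reflexive (solve 2 (λ c k →
    con 2 :* c :* (c :+ k) :+ k :* k := (c :+ k) :* (c :+ k) :+ c :* c) refl c k))
  where open +-*-Solver
... | inj₂ t≤c with k , refl ← m≤n⇒∃[o]m+o≡n t≤c =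
  m+n≤o⇒m≤o (2 * (t + k) * t) {k * k} (≤-reflexive (solve 2 (λ t k →
    con 2 :* (t :+ k) :* t :+ k :* k := t :* t :+ (t :+ k) :* (t :+ k)) refl t k))
  where open +-*-Solver

Graph : ℕ → Set
Graph m = Fin m → Fin m → Bool

record C4Free (G : Graph m) : Set where
  field
    symm   : ∀ {x y} → T (G x y) → T (G y x)
    irrefl : ∀ {x} → ¬ T (G x x)
    no-C4  : ∀ {x y a b} → x ≢ y → T (G x a) → T (G y a) → T (G x b) → T (G y b) → a ≡ b

degree : Graph m → Fin m → ℕ
degree G x = card (G x)

linked : Graph m → Fin m → Fin m → Bool
linked G x y = not (does (x ≟ y)) ∧ ⌊ Fin.any? (λ a → T? (G x a ∧ G y a)) ⌋

linked-intro : (G : Graph m) {x y a : Fin m} → x ≢ y → T (G x a) → T (G y a) → T (linked G x y)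
linked-intro G {x} {y} {a} x≢y xa ya with x ≟ y
... | yes eq = contradiction eq x≢y
... | no _   = fromWitness (a , Equivalence.from T-∧ (xa , ya))

linked-elim : (G : Graph m) {x y : Fin m} → T (linked G x y) → x ≢ y × ∃[ a ] T (G x a) × T (G y a)
linked-elim G {x} {y} t with x ≟ y
... | no x≢y with a , t′ ← toWitness t = x≢y , a , Equivalence.to T-∧ t′

𝟙-∧ : ∀ a b → 𝟙 (a ∧ b) ≡ 𝟙 a * 𝟙 b
𝟙-∧ true  b = sym (+-identityʳ (𝟙 b))
𝟙-∧ false b = refl

module _ {G : Graph m} (free : C4Free G) where
  open C4Free free

  -- Distinct vertices have one common neighbour or none, according to whether they are linked; the
  -- diagonal contributes the degree.
  codegree-≤ : ∀ x y → sum (λ a → 𝟙 (G x a) * 𝟙 (G y a)) ≤ 𝟙 (linked G x y) + 𝟙 (does (x ≟ y)) * degree G x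
  codegree-≤ x y = ≤-trans (≤-reflexive (sum-cong-≗ λ a → sym (𝟙-∧ (G x a) (G y a)))) bound′
    where
    bound′ : sum (λ a → 𝟙 (G x a ∧ G y a)) ≤ 𝟙 (linked G x y) + 𝟙 (does (x ≟ y)) * degree G x
    bound′ with x ≟ y
    ... | yes refl = ≤-trans (card-mono {S = λ a → G x a ∧ G x a} {G x} (λ a → proj₁ ∘ Equivalence.to T-∧)) (≤-reflexive (sym (+-identityʳ _)))
    ... | no x≢y with Fin.any? (λ a → T? (G x a ∧ G y a))
    ...   | yes _ = sum-unique (λ a → G x a ∧ G y a) λ s t →
              let xa , ya = Equivalence.to T-∧ s ; xb , yb = Equivalence.to T-∧ t in no-C4 x≢y xa ya xb yb
    ...   | no ¬∃ = ≤-reflexive (trans (sum-cong-≗ (λ a → none a)) (trans (sum-const m 0) (*-zeroʳ m)))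
      where
      none : ∀ a → 𝟙 (G x a ∧ G y a) ≡ 0
      none a with G x a ∧ G y a in eq
      ... | false = refl
      ... | true  = contradiction (a , subst T (sym eq) tt) ¬∃

  -- Paths of length two between vertices of X are counted by their middle vertex a. If t a
  -- is the number of neighbours of a in X then t² ≥ 2ct − c², which replaces Cauchy–Schwarz.
  module _ (X : Sub m) where

    t : Fin m → ℕ
    t a = sum (λ x → 𝟙 (X x) * 𝟙 (G x a))

    linkedPairs : ℕ
    linkedPairs = sum (λ x → 𝟙 (X x) * degreeIn (linked G) X x)

    sum-t : sum t ≡ sum (λ x → 𝟙 (X x) * degree G x)
    sum-t = begin
      sum t                                                ≡⟨ sum-cong-≗ (λ a → *-identityˡ (t a)) ⟨
      sum (λ a → 1 * t a)                                  ≡⟨ sum-exchange (λ _ → 1) (𝟙 ∘ X) (λ x a → 𝟙 (G x a)) ⟩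
      sum (λ x → 𝟙 (X x) * sum (λ a → 1 * 𝟙 (G x a)))      ≡⟨ sum-cong-≗ (λ x → cong (𝟙 (X x) *_) (sum-cong-≗ λ a → *-identityˡ (𝟙 (G x a)))) ⟩
      sum (λ x → 𝟙 (X x) * degree G x)                     ∎
      where open ≡-Reasoning

    paths-from : ∀ x → sum (λ a → 𝟙 (G x a) * t a) ≤ degreeIn (linked G) X x + degree G x
    paths-from x = begin
      sum (λ a → 𝟙 (G x a) * t a)
        ≡⟨ sum-exchange (𝟙 ∘ G x) (𝟙 ∘ X) (λ y a → 𝟙 (G y a)) ⟩
      sum (λ y → 𝟙 (X y) * sum (λ a → 𝟙 (G x a) * 𝟙 (G y a)))
        ≤⟨ sum-mono (λ y → *-monoʳ-≤ (𝟙 (X y)) (codegree-≤ x y)) ⟩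
      sum (λ y → 𝟙 (X y) * (𝟙 (linked G x y) + 𝟙 (does (x ≟ y)) * degree G x))
        ≤⟨ sum-mono (λ y → restrict (X y) (linked G x y) (𝟙 (does (x ≟ y)) * degree G x)) ⟩
      sum (λ y → 𝟙 (X y ∧ linked G x y) + 𝟙 (does (x ≟ y)) * degree G x)
        ≡⟨ ∑-distrib-+ (λ y → 𝟙 (X y ∧ linked G x y)) (λ y → 𝟙 (does (x ≟ y)) * degree G x) ⟩
      degreeIn (linked G) X x + sum (λ y → 𝟙 (does (x ≟ y)) * degree G x)
        ≤⟨ +-monoʳ-≤ (degreeIn (linked G) X x) (sum-select x (degree G x)) ⟩
      degreeIn (linked G) X x + degree G x ∎
      where
      open ≤-Reasoning
      restrict : ∀ a b c → 𝟙 a * (𝟙 b + c) ≤ 𝟙 (a ∧ b) + c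
      restrict true  b c = ≤-reflexive (+-identityʳ (𝟙 b + c))
      restrict false b c = z≤n

    -- Walks x, a, y with both ends in `X` are counted. Those with distinct ends give each linked
    -- pair at most once, and those with x = y number at most `sum t`.
    sum-t² : sum (λ a → t a * t a) ≤ linkedPairs + sum t
    sum-t² = begin
      sum (λ a → t a * t a)
        ≡⟨ sum-exchange t (𝟙 ∘ X) (λ x a → 𝟙 (G x a)) ⟩
      sum (λ x → 𝟙 (X x) * sum (λ a → t a * 𝟙 (G x a)))
        ≡⟨ sum-cong-≗ (λ x → cong (𝟙 (X x) *_) (sum-cong-≗ λ a → *-comm (t a) (𝟙 (G x a)))) ⟩
      sum (λ x → 𝟙 (X x) * sum (λ a → 𝟙 (G x a) * t a))
        ≤⟨ sum-mono (λ x → *-monoʳ-≤ (𝟙 (X x)) (paths-from x)) ⟩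
      sum (λ x → 𝟙 (X x) * (degreeIn (linked G) X x + degree G x))
        ≡⟨ sum-cong-≗ (λ x → *-distribˡ-+ (𝟙 (X x)) (degreeIn (linked G) X x) (degree G x)) ⟩
      sum (λ x → 𝟙 (X x) * degreeIn (linked G) X x + 𝟙 (X x) * degree G x)
        ≡⟨ ∑-distrib-+ (λ x → 𝟙 (X x) * degreeIn (linked G) X x) (λ x → 𝟙 (X x) * degree G x) ⟩
      linkedPairs + sum (λ x → 𝟙 (X x) * degree G x)
        ≡⟨ cong (linkedPairs +_) sum-t ⟨
      linkedPairs + sum t ∎
      where open ≤-Reasoning

    module _ (D c : ℕ) (min-degree : ∀ x → D ≤ degree G x) (c*m≤ : suc c * m ≤ card X * D) where

      sum-t-≥ : card X * D ≤ sum t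
      sum-t-≥ = begin
        card X * D                        ≡⟨ *-distribʳ-sum D (𝟙 ∘ X) ⟩
        sum (λ x → 𝟙 (X x) * D)           ≤⟨ sum-mono (λ x → *-monoʳ-≤ (𝟙 (X x)) (min-degree x)) ⟩
        sum (λ x → 𝟙 (X x) * degree G x)  ≡⟨ sum-t ⟨
        sum t                             ∎
        where open ≤-Reasoning

      -- The tangent to t² is taken at c + 1, which is at most the average of `t`. It gives Σ t² ≥
      -- (c + 1) Σ t, and the walks with equal ends take away one Σ t.
      linkedPairs-≥ : c * sum t ≤ linkedPairs
      linkedPairs-≥ = +-cancelʳ-≤ (sum t + suc c * sum t) _ _ (begin
        c * P + (P + suc c * P)         ≡⟨ solve 2 (λ c P → c :* P :+ (P :+ (con 1 :+ c) :* P) := con 2 :* (con 1 :+ c) :* P) refl c P ⟩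
        2 * suc c * P                   ≡⟨ *-distribˡ-sum (2 * suc c) t ⟩
        sum (λ a → 2 * suc c * t a)     ≤⟨ sum-mono (λ a → 2ct≤t²+c² (suc c) (t a)) ⟩
        sum (λ a → t a * t a + suc c * suc c)  ≡⟨ ∑-distrib-+ (λ a → t a * t a) (λ _ → suc c * suc c) ⟩
        sum (λ a → t a * t a) + sum {m} (λ _ → suc c * suc c)  ≤⟨ +-mono-≤ sum-t² (≤-reflexive (sum-const m (suc c * suc c))) ⟩
        linkedPairs + P + m * (suc c * suc c)  ≡⟨ cong (linkedPairs + P +_) (solve 2 (λ c m → m :* ((con 1 :+ c) :* (con 1 :+ c)) := (con 1 :+ c) :* ((con 1 :+ c) :* m)) refl c m) ⟩
        linkedPairs + P + suc c * (suc c * m)  ≤⟨ +-monoʳ-≤ (linkedPairs + P) (*-monoʳ-≤ (suc c) (≤-trans c*m≤ sum-t-≥)) ⟩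
        linkedPairs + P + suc c * P     ≡⟨ +-assoc linkedPairs P (suc c * P) ⟩
        linkedPairs + (P + suc c * P)   ∎)
        where
        open ≤-Reasoning
        open +-*-Solver
        P : ℕ
        P = sum t

      -- Averaging: the degrees inside `X` add up to at least c D |X|. In the refutation each vertex
      -- of `X` falls short of c D by at least one, which is the summand `card X`.
      high-degree : 0 < card X → ∃[ x ] T (X x) × c * D ≤ degreeIn (linked G) X x
      high-degree 0<X with Fin.any? (λ x → T? (X x) ×-dec (c * D ≤? degreeIn (linked G) X x))
      ... | yes p = p
      ... | no ¬∃ = contradiction 0<X (≤⇒≯ (+-cancelˡ-≤ linkedPairs (card X) 0 (begin
        linkedPairs + card X
          ≡⟨ ∑-distrib-+ (λ x → 𝟙 (X x) * degreeIn (linked G) X x) (𝟙 ∘ X) ⟨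
        sum (λ x → 𝟙 (X x) * degreeIn (linked G) X x + 𝟙 (X x))
          ≤⟨ sum-mono few ⟩
        sum (λ x → 𝟙 (X x) * (c * D))
          ≡⟨ *-distribʳ-sum (c * D) (𝟙 ∘ X) ⟨
        card X * (c * D)
          ≡⟨ solve 3 (λ a b c → a :* (b :* c) := b :* (a :* c)) refl (card X) c D ⟩
        c * (card X * D)
          ≤⟨ *-monoʳ-≤ c sum-t-≥ ⟩
        c * sum t
          ≤⟨ linkedPairs-≥ ⟩
        linkedPairs
          ≡⟨ +-identityʳ linkedPairs ⟨
        linkedPairs + 0 ∎)))
        where
        open ≤-Reasoning
        open +-*-Solver
        few : ∀ x → 𝟙 (X x) * degreeIn (linked G) X x + 𝟙 (X x) ≤ 𝟙 (X x) * (c * D)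
        few x with X x in eq
        ... | false = z≤n
        ... | true  = begin
          degreeIn (linked G) X x + 0 + 1  ≡⟨ cong (_+ 1) (+-identityʳ _) ⟩
          degreeIn (linked G) X x + 1      ≡⟨ +-comm _ 1 ⟩
          suc (degreeIn (linked G) X x)    ≤⟨ ≰⇒> (λ le → ¬∃ (x , subst T (sym eq) tt , le)) ⟩
          c * D                            ≡⟨ +-identityʳ (c * D) ⟨
          c * D + 0                        ∎

-- Numbers of subsets of bounded size

subsets-trivial : ∀ k d → subsets k d ≤ suc k ^ d
subsets-trivial k       zero    = ≤-refl
subsets-trivial zero    (suc d) = ≤-reflexive (sym (^-zeroˡ (suc d)))
subsets-trivial (suc k) (suc d) = begin
  subsets k (suc d) + subsets k d  ≤⟨ +-mono-≤ (subsets-trivial k (suc d)) (subsets-trivial k d) ⟩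
  suc k ^ suc d + suc k ^ d        ≡⟨ +-comm (suc k ^ suc d) (suc k ^ d) ⟩
  suc (suc k) * suc k ^ d          ≤⟨ *-monoʳ-≤ (suc (suc k)) (^-monoˡ-≤ d (n≤1+n (suc k))) ⟩
  suc (suc k) ^ suc d              ∎
  where open ≤-Reasoning

-- Σ_{i≤d} (k choose i) λ^d ≤ (1 + λ)^k for λ = 1/M ≤ 1.
subsets-weight : ∀ M .{{_ : NonZero M}} k d → subsets k d * M ^ k ≤ suc M ^ k * M ^ d
subsets-weight M k zero = begin
  1 * M ^ k      ≡⟨ *-comm 1 (M ^ k) ⟩
  M ^ k * 1      ≤⟨ *-monoˡ-≤ 1 (^-monoˡ-≤ k (n≤1+n M)) ⟩
  suc M ^ k * 1  ∎
  where open ≤-Reasoning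
subsets-weight M zero (suc d) = ≤-trans (m^n>0 M (suc d)) (≤-reflexive (sym (+-identityʳ _)))
subsets-weight M (suc k) (suc d) = begin
  (a + a′) * (M * M ^ k)               ≡⟨ solve 4 (λ a a′ M p → (a :+ a′) :* (M :* p) := M :* (a :* p) :+ M :* (a′ :* p)) refl a a′ M (M ^ k) ⟩
  M * (a * M ^ k) + M * (a′ * M ^ k)   ≤⟨ +-mono-≤ (*-monoʳ-≤ M (subsets-weight M k (suc d))) (*-monoʳ-≤ M (subsets-weight M k d)) ⟩
  M * (q * (M * M ^ d)) + M * (q * M ^ d) ≡⟨ solve 3 (λ M q p → M :* (q :* (M :* p)) :+ M :* (q :* p) := (con 1 :+ M) :* q :* (M :* p)) refl M q (M ^ d) ⟩
  suc M * q * (M * M ^ d)              ∎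
  where
  open ≤-Reasoning
  open +-*-Solver
  a a′ q : ℕ
  a  = subsets k (suc d)
  a′ = subsets k d
  q  = suc M ^ k

-- (1 + 1/M)^h ≤ (M + 1) / (M + 1 − h), i.e. Bernoulli's inequality for 1 − 1/(M + 1).
bernoulli : ∀ M h k → h + k ≡ M → suc M ^ h * suc k ≤ suc M * M ^ h
bernoulli M zero    k refl = ≤-reflexive (trans (+-identityʳ (suc k)) (sym (*-identityʳ (suc k))))
bernoulli M (suc h) k eq = begin
  suc M * suc M ^ h * suc k      ≡⟨ solve 3 (λ a b c → a :* b :* c := b :* (a :* c)) refl (suc M) (suc M ^ h) (suc k) ⟩
  suc M ^ h * (suc M * suc k)    ≤⟨ *-monoʳ-≤ (suc M ^ h) grow ⟩
  suc M ^ h * (M * suc (suc k))  ≡⟨ solve 3 (λ a b c → a :* (b :* c) := b :* (a :* c)) refl (suc M ^ h) M (suc (suc k)) ⟩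
  M * (suc M ^ h * suc (suc k))  ≤⟨ *-monoʳ-≤ M (bernoulli M h (suc k) (trans (+-suc h k) eq)) ⟩
  M * (suc M * M ^ h)            ≡⟨ solve 3 (λ a b c → a :* (b :* c) := b :* (a :* c)) refl M (suc M) (M ^ h) ⟩
  suc M * (M * M ^ h)            ∎
  where
  open ≤-Reasoning
  open +-*-Solver
  grow : suc M * suc k ≤ M * suc (suc k)
  grow = begin
    suc k + M * suc k  ≤⟨ +-monoˡ-≤ (M * suc k) (≤-trans (m≤n+m (suc k) h) (≤-reflexive (trans (+-suc h k) eq))) ⟩
    M + M * suc k      ≡⟨ *-suc M (suc k) ⟨
    M * suc (suc k)    ∎

-- Bernoulli's inequality gives (1 + 1/M)^(M/2) ≤ 2, and squaring gives the constant 4. For a power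
-- of two above 1, M/2 is an integer.
suc-2^-^ : ∀ t → suc (2 ^ t) ^ (2 ^ t) ≤ 4 * (2 ^ t) ^ (2 ^ t)
suc-2^-^ zero = s≤s (s≤s z≤n)
suc-2^-^ (suc t) = begin
  suc M ^ M                    ≡⟨ cong (suc M ^_) M≡h+h ⟩
  suc M ^ (h + h)              ≡⟨ ^-distribˡ-+-* (suc M) h h ⟩
  suc M ^ h * suc M ^ h        ≤⟨ *-mono-≤ half half ⟩
  2 * M ^ h * (2 * M ^ h)      ≡⟨ solve 1 (λ a → con 2 :* a :* (con 2 :* a) := con 4 :* (a :* a)) refl (M ^ h) ⟩
  4 * (M ^ h * M ^ h)          ≡⟨ cong (4 *_) (^-distribˡ-+-* M h h) ⟨
  4 * M ^ (h + h)              ≡⟨ cong (λ e → 4 * M ^ e) M≡h+h ⟨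
  4 * M ^ M                    ∎
  where
  open ≤-Reasoning
  open +-*-Solver
  h M : ℕ
  h = 2 ^ t
  M = 2 * h
  M≡h+h : M ≡ h + h
  M≡h+h = cong (h +_) (+-identityʳ h)
  half : suc M ^ h ≤ 2 * M ^ h
  half = *-cancelˡ-≤ (suc h) (begin
    suc h * suc M ^ h     ≡⟨ *-comm (suc h) (suc M ^ h) ⟩
    suc M ^ h * suc h     ≤⟨ bernoulli M h h (sym M≡h+h) ⟩
    suc M * M ^ h         ≤⟨ *-monoˡ-≤ (M ^ h) (s≤s (≤-trans (n≤1+n M) (≤-reflexive (trans (cong suc M≡h+h) (trans (sym (+-suc h h)) (cong (h +_) (sym (+-identityʳ (suc h)))))))))  ⟩
    2 * suc h * M ^ h     ≡⟨ solve 2 (λ a b → con 2 :* a :* b := a :* (con 2 :* b)) refl (suc h) (M ^ h) ⟩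
    suc h * (2 * M ^ h)   ∎)

_≗₂_ : Graph m → Graph m → Set
G ≗₂ G′ = ∀ x y → G x y ≡ G′ x y

n<2^n : ∀ n → n < 2 ^ n
n<2^n zero    = s≤s z≤n
n<2^n (suc n) = +-mono-≤ (m^n>0 2 n) (≤-trans (n<2^n n) (≤-reflexive (sym (+-identityʳ (2 ^ n)))))

^-distribʳ-* : ∀ n a b → (a * b) ^ n ≡ a ^ n * b ^ n
^-distribʳ-* zero    a b = refl
^-distribʳ-* (suc n) a b = trans (cong (a * b *_) (^-distribʳ-* n a b))
  (solve 4 (λ a b p q → a :* b :* (p :* q) := a :* p :* (b :* q)) refl a b (a ^ n) (b ^ n))
  where open +-*-Solver

subsets-mono : ∀ {k l} d → k ≤ l → subsets k d ≤ subsets l d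
subsets-mono         zero    k≤l       = ≤-refl
subsets-mono {l = l} (suc d) z≤n       = positive l (suc d)
  where
  positive : ∀ l d → 1 ≤ subsets l d
  positive l       zero    = ≤-refl
  positive zero    (suc d) = ≤-refl
  positive (suc l) (suc d) = ≤-trans (positive l (suc d)) (m≤m+n _ _)
subsets-mono         (suc d) (s≤s k≤l) = +-mono-≤ (subsets-mono (suc d) k≤l) (subsets-mono d k≤l)

-- Here the logarithm disappears. The weight is 1/M with M = 2^e and e the integer part of s / D.
-- Then M ≥ s / D, so K = 2sM is at least k, and (1 + 1/M)^K ≤ 4^(2s). On the other side e and e D
-- are at most s, so M^(D + 1) ≤ 2^(2s).
subsets-base : ∀ s D k .{{_ : NonZero D}} → k * D ≤ 2 * (s * s) → subsets k (suc D) ≤ 2 ^ (6 * s)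
subsets-base s D k kD≤ = *-cancelʳ-≤ _ _ (M ^ K) {{m^n≢0 M K}} (begin
  subsets k (suc D) * M ^ K     ≤⟨ *-monoˡ-≤ (M ^ K) (subsets-mono (suc D) k≤K) ⟩
  subsets K (suc D) * M ^ K     ≤⟨ subsets-weight M K (suc D) ⟩
  suc M ^ K * M ^ suc D         ≤⟨ *-mono-≤ powM powD ⟩
  2 ^ (4 * s) * M ^ K * 2 ^ (2 * s)  ≡⟨ solve 3 (λ a b c → a :* b :* c := a :* c :* b) refl (2 ^ (4 * s)) (M ^ K) (2 ^ (2 * s)) ⟩
  2 ^ (4 * s) * 2 ^ (2 * s) * M ^ K  ≡⟨ cong (_* M ^ K) (^-distribˡ-+-* 2 (4 * s) (2 * s)) ⟨
  2 ^ (4 * s + 2 * s) * M ^ K        ≡⟨ cong (λ x → 2 ^ x * M ^ K) (*-distribʳ-+ s 4 2) ⟨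
  2 ^ (6 * s) * M ^ K                ∎)
  where
  open ≤-Reasoning
  open +-*-Solver
  e M K : ℕ
  e = s / D
  M = 2 ^ e
  K = M * (2 * s)
  instance
    M≢0 : NonZero M
    M≢0 = m^n≢0 2 e

  s≤MD : s ≤ M * D
  s≤MD = begin
    s                  ≡⟨ m≡m%n+[m/n]*n s D ⟩
    _ + e * D          ≤⟨ +-monoˡ-≤ (e * D) (<⇒≤ (m%n<n s D)) ⟩
    suc e * D          ≤⟨ *-monoˡ-≤ D (n<2^n e) ⟩
    M * D              ∎

  k≤K : k ≤ K
  k≤K = *-cancelʳ-≤ k K D (begin
    k * D              ≤⟨ kD≤ ⟩
    2 * (s * s)        ≤⟨ *-monoʳ-≤ 2 (*-monoʳ-≤ s s≤MD) ⟩
    2 * (s * (M * D))  ≡⟨ solve 3 (λ s M D → con 2 :* (s :* (M :* D)) := M :* (con 2 :* s) :* D) refl s M D ⟩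
    K * D              ∎)

  powM : suc M ^ K ≤ 2 ^ (4 * s) * M ^ K
  powM = begin
    suc M ^ (M * (2 * s))                ≡⟨ ^-*-assoc (suc M) M (2 * s) ⟨
    (suc M ^ M) ^ (2 * s)                ≤⟨ ^-monoˡ-≤ (2 * s) (suc-2^-^ e) ⟩
    (4 * M ^ M) ^ (2 * s)                ≡⟨ ^-distribʳ-* (2 * s) 4 (M ^ M) ⟩
    (2 ^ 2) ^ (2 * s) * (M ^ M) ^ (2 * s)  ≡⟨ cong₂ _*_ (^-*-assoc 2 2 (2 * s)) (^-*-assoc M M (2 * s)) ⟩
    2 ^ (2 * (2 * s)) * M ^ K            ≡⟨ cong (λ x → 2 ^ x * M ^ K) (*-assoc 2 2 s) ⟨
    2 ^ (4 * s) * M ^ K                  ∎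

  powD : M ^ suc D ≤ 2 ^ (2 * s)
  powD = begin
    (2 ^ e) ^ suc D  ≡⟨ ^-*-assoc 2 e (suc D) ⟩
    2 ^ (e * suc D)  ≡⟨ cong (2 ^_) (*-suc e D) ⟩
    2 ^ (e + e * D)  ≤⟨ ^-monoʳ-≤ 2 (+-mono-≤ (m/n≤m s D) (≤-trans (m/n*n≤m s D) (≤-reflexive (sym (+-identityʳ s))))) ⟩
    2 ^ (2 * s)      ∎

-- Counting C₄-free graphs

-- `D` is one less than the degree of the deleted vertex: other degrees may drop by one, and its
-- neighbourhood has up to `suc D` elements.
Extends : Graph m → ℕ → Sub m → Set
Extends G D S = C4Free G × (∀ x → D ≤ degree G x)
              × (∀ {x y} → T (S x) → T (S y) → ¬ T (linked G x y)) × card S ≤ suc D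

card-full : card {m} (λ _ → true) ≡ m
card-full {m} = trans (sum-const m 1) (*-identityʳ m)

-- The scale s satisfies s² = 256^w > m, and all bounds have the form 2^(O(s)). Powers of 16
-- make the polylogarithmic factor w⁴ smaller than s.
module Scale (w : ℕ) where

  s : ℕ
  s = 2 ^ (w * 4)

  s*s≡ : s * s ≡ 2 ^ (8 * w)
  s*s≡ = trans (sym (^-distribˡ-+-* 2 (w * 4) (w * 4)))
               (cong (2 ^_) (solve 1 (λ w → w :* con 4 :+ w :* con 4 := con 8 :* w) refl w))
    where open +-*-Solver

  w^4≤s : w ^ 4 ≤ s
  w^4≤s = ≤-trans (^-monoˡ-≤ 4 (<⇒≤ (n<2^n w))) (≤-reflexive (^-*-assoc 2 w 4))

  w≤s : w ≤ s
  w≤s = ≤-trans (<⇒≤ (n<2^n w)) (^-monoʳ-≤ 2 (m≤m*n w 4))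

  module _ {m : ℕ} (m<s² : suc m ≤ 2 ^ (8 * w)) where

    -- The crude bound (m + 1)^(D + 1) ≤ 2^(8w(D + 1)) suffices, as both w and w D are at most s.
    cover-low : ∀ G D → w * D ≤ s → Cover _≗_ (Extends {m} G D) (2 ^ (134 * s))
    cover-low G D wD≤s = cover-≤ (begin
      subsets m (suc D)       ≤⟨ subsets-trivial m (suc D) ⟩
      suc m ^ suc D           ≤⟨ ^-monoˡ-≤ (suc D) m<s² ⟩
      (2 ^ (8 * w)) ^ suc D   ≡⟨ ^-*-assoc 2 (8 * w) (suc D) ⟩
      2 ^ (8 * w * suc D)     ≡⟨ cong (2 ^_) (solve 2 (λ w D → con 8 :* w :* (con 1 :+ D) := con 8 :* (w :+ w :* D)) refl w D) ⟩
      2 ^ (8 * (w + w * D))   ≤⟨ ^-monoʳ-≤ 2 (*-monoʳ-≤ 8 (+-mono-≤ w≤s wD≤s)) ⟩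
      2 ^ (8 * (s + s))       ≡⟨ cong (2 ^_) (solve 1 (λ s → con 8 :* (s :+ s) := con 16 :* s) refl s) ⟩
      2 ^ (16 * s)            ≤⟨ ^-monoʳ-≤ 2 (*-monoˡ-≤ s (m≤m+n 16 118)) ⟩
      2 ^ (134 * s)           ∎)
      (cover-⊆ (λ { (_ , _ , _ , S≤) → (λ _ _ → tt) , S≤ }) (cover-subsets m (suc D) (λ _ → true) card-full))
      where
      open ≤-Reasoning
      open +-*-Solver

    module _ (G : Graph m) (D : ℕ) (D≤m : D ≤ m) (s<wD : s < w * D) where

      extends-∖ : ∀ {S x} → Extends G D S → Extends G D (S ∖ x)
      extends-∖ {S} {x} (free , deg , ind , S≤) =
          free , deg
        , (λ {y} {z} Sy Sz → ind (∖-⊆ S x y Sy) (∖-⊆ S x z Sz))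
        , ≤-trans (card-mono {S = S ∖ x} {S} (∖-⊆ S x)) S≤

      extends-independent : ∀ {S x y} → Extends G D S → T (S x) → T (S y) → ¬ T (linked G x y)
      extends-independent (_ , _ , ind , _) = ind

      open Container (linked G) (Extends G D) extends-∖ extends-independent D

      D≢0 : NonZero D
      D≢0 = ≢-nonZero λ { refl → contradiction (≤-trans s<wD (≤-reflexive (*-zeroʳ w))) λ () }

      m≤s² : m ≤ s * s
      m≤s² = ≤-trans (n≤1+n m) (≤-trans m<s² (≤-reflexive (sym s*s≡)))

      base : Bounded (2 ^ 1 * (s * s)) (2 ^ (6 * s)) 0
      base X X≤ = cover-≤
        (≤-trans (subsets-base s D (card X) {{D≢0}} X≤) (≤-reflexive (sym (*-identityʳ _))))
        (cover-⊆ (λ { (S⊆X , _ , _ , _ , S≤) → S⊆X , S≤ }) (cover-subsets (card X) (suc D) X refl))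

      -- While |X| D > 2^(i+1) s², a branching vertex has at least (2^(i+1) − 1) D neighbours in
      -- X, and h D² ≥ 2 s², so h of them halve the bound on |X| D.
      h : ℕ
      h = 2 * (w * w)

      dense : ∀ i {σ} → 2 ^ suc i * (s * s) ≤ σ → Dense σ (pred (2 ^ suc i) * D)
      dense i τ≤σ (free , deg , _) X σ< = high-degree free X D (pred (2 ^ suc i)) deg
        (≤-trans (≤-reflexive (cong (_* m) (suc-pred (2 ^ suc i) {{m^n≢0 2 (suc i)}})))
          (≤-trans (*-monoʳ-≤ (2 ^ suc i) m≤s²) (≤-trans τ≤σ (<⇒≤ σ<))))
        (n≢0⇒n>0 λ eq → contradiction (subst (λ c → _ < c * D) eq σ<) λ ())

      level : ∀ i → Bounded (2 ^ suc i * (s * s)) (2 ^ (6 * s)) (i * h)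
      level zero    = base
      level (suc i) X X≤ = steps {b = 2 ^ (6 * s)} {i * h} (dense i) (level i) h X (≤-trans X≤ (begin
        2 * p * (s * s)                        ≡⟨ solve 2 (λ p s → con 2 :* p :* (s :* s) := p :* (s :* s) :+ p :* (s :* s)) refl p s ⟩
        p * (s * s) + p * (s * s)              ≤⟨ +-monoʳ-≤ (p * (s * s)) (*-mono-≤ p≤2c (*-mono-≤ (<⇒≤ s<wD) (<⇒≤ s<wD))) ⟩
        p * (s * s) + (c + c) * (w * D * (w * D))  ≡⟨ cong (p * (s * s) +_) (solve 3 (λ c w D → (c :+ c) :* (w :* D :* (w :* D)) := con 2 :* (w :* w) :* (c :* D :* D)) refl c w D) ⟩
        p * (s * s) + h * (c * D * D)          ∎))
        where
        open ≤-Reasoning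
        open +-*-Solver
        p c : ℕ
        p = 2 ^ suc i
        c = pred p
        p≤2c : p ≤ c + c
        p≤2c = begin
          p      ≡⟨ suc-pred p {{m^n≢0 2 (suc i)}} ⟨
          suc c  ≤⟨ +-monoˡ-≤ c (≤-pred (≤-trans (*-monoʳ-≤ 2 (m^n>0 2 i)) (≤-reflexive (sym (suc-pred p {{m^n≢0 2 (suc i)}}))))) ⟩
          c + c  ∎

      -- As m D ≤ 2^(8w) s², `8 * w` doublings of the threshold reach the full vertex set. At most 8
      -- w h vertices are accepted, each costing a factor m + 1 ≤ 2^(8w), whence the exponent 8w ·
      -- 8w · 2w² = 128 w⁴.
      cover-high : Cover _≗_ (Extends G D) (2 ^ (134 * s))
      cover-high = cover-≤ (begin
        2 ^ (6 * s) * suc (card {m} (λ _ → true)) ^ (8 * w * h)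
          ≤⟨ *-monoʳ-≤ (2 ^ (6 * s)) (^-monoˡ-≤ (8 * w * h) (≤-trans (s≤s (card-≤ {m} (λ _ → true))) m<s²)) ⟩
        2 ^ (6 * s) * (2 ^ (8 * w)) ^ (8 * w * h)
          ≡⟨ cong (2 ^ (6 * s) *_) (^-*-assoc 2 (8 * w) (8 * w * h)) ⟩
        2 ^ (6 * s) * 2 ^ (8 * w * (8 * w * h))
          ≡⟨ ^-distribˡ-+-* 2 (6 * s) (8 * w * (8 * w * h)) ⟨
        2 ^ (6 * s + 8 * w * (8 * w * h))
          ≡⟨ cong (λ e → 2 ^ (6 * s + e)) (solve 1 (λ w → con 8 :* w :* (con 8 :* w :* (con 2 :* (w :* w))) := con 128 :* (w :* (w :* (w :* (w :* con 1))))) refl w) ⟩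
        2 ^ (6 * s + 128 * w ^ 4)
          ≤⟨ ^-monoʳ-≤ 2 (+-monoʳ-≤ (6 * s) (*-monoʳ-≤ 128 w^4≤s)) ⟩
        2 ^ (6 * s + 128 * s)
          ≡⟨ cong (2 ^_) (*-distribʳ-+ s 6 128) ⟨
        2 ^ (134 * s) ∎)
        (cover-⊆ (λ QS → (λ _ _ → tt) , QS) (level (8 * w) (λ _ → true) (begin
          card {m} (λ _ → true) * D    ≤⟨ *-mono-≤ (≤-trans (card-≤ {m} (λ _ → true)) m≤s²) (≤-trans D≤m (≤-trans (n≤1+n m) m<s²)) ⟩
          s * s * 2 ^ (8 * w)          ≡⟨ *-comm (s * s) _ ⟩
          2 ^ (8 * w) * (s * s)        ≤⟨ *-monoˡ-≤ (s * s) (^-monoʳ-≤ 2 (n≤1+n (8 * w))) ⟩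
          2 ^ suc (8 * w) * (s * s)    ∎)))
        where
        open ≤-Reasoning
        open +-*-Solver

    cover-extensions : ∀ G D → D ≤ m → Cover _≗_ (Extends G D) (2 ^ (134 * s))
    cover-extensions G D D≤m with w * D ≤? s
    ... | yes wD≤s = cover-low G D wD≤s
    ... | no  wD≰s = cover-high G D D≤m (≰⇒> wD≰s)

-- Deleting and restoring a vertex of minimum degree

argmin : (f : Fin (suc m) → ℕ) → ∃[ v ] ∀ x → f v ≤ f x
argmin {zero}  f = zero , λ { zero → ≤-refl }
argmin {suc m} f with v , min ← argmin (f ∘ suc) with ≤-total (f zero) (f (suc v))
... | inj₁ le = zero , λ { zero → ≤-refl ; (suc x) → ≤-trans le (min x) }
... | inj₂ le = suc v , λ { zero → le ; (suc x) → min x }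

C4Free-resp : {G G′ : Graph m} → G ≗₂ G′ → C4Free G′ → C4Free G
C4Free-resp G≗G′ free = record
  { symm   = λ {x} {y} → from y x ∘ symm ∘ to x y
  ; irrefl = λ {x} → irrefl ∘ to x x
  ; no-C4  = λ {x} {y} {a} {b} x≢y xa ya xb yb →
               no-C4 x≢y (to x a xa) (to y a ya) (to x b xb) (to y b yb)
  }
  where
  open C4Free free
  to   = λ x y → subst T (G≗G′ x y)
  from = λ x y → subst T (sym (G≗G′ x y))

remove : Fin (suc m) → Graph (suc m) → Graph m
remove v G x y = G (punchIn v x) (punchIn v y)

neighbours : Fin (suc m) → Graph (suc m) → Sub m
neighbours v G y = G v (punchIn v y)

extend : Fin (suc m) → Graph m → Sub m → Graph (suc m)
extend v G S x y with v ≟ x | v ≟ y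
... | yes _  | yes _  = false
... | yes _  | no v≢y = S (punchOut v≢y)
... | no v≢x | yes _  = S (punchOut v≢x)
... | no v≢x | no v≢y = G (punchOut v≢x) (punchOut v≢y)

T-ext : ∀ {a b} → (T a → T b) → (T b → T a) → a ≡ b
T-ext {true}  {true}  _ _ = refl
T-ext {false} {false} _ _ = refl
T-ext {true}  {false} f _ = ⊥-elim (f tt)
T-ext {false} {true}  _ g = ⊥-elim (g tt)

module _ {G : Graph (suc m)} (free : C4Free G) (v : Fin (suc m)) where
  open C4Free free

  extend-remove : ∀ {G′ S} → G′ ≗₂ remove v G → S ≗ neighbours v G → extend v G′ S ≗₂ G
  extend-remove G′≗ S≗ x y with v ≟ x | v ≟ y
  ... | yes refl | yes refl = T-ext (λ ()) irrefl
  ... | yes refl | no v≢y   = trans (S≗ _) (cong (G v) (Fin.punchIn-punchOut v≢y))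
  ... | no v≢x   | yes refl = trans (S≗ _)
    (trans (cong (G v) (Fin.punchIn-punchOut v≢x)) (T-ext symm symm))
  ... | no v≢x   | no v≢y   = trans (G′≗ _ _)
    (cong₂ G (Fin.punchIn-punchOut v≢x) (Fin.punchIn-punchOut v≢y))

  C4Free-remove : C4Free (remove v G)
  C4Free-remove = record
    { symm   = symm
    ; irrefl = irrefl
    ; no-C4  = λ x≢y xa ya xb yb → Fin.punchIn-injective v _ _
                 (no-C4 (x≢y ∘ Fin.punchIn-injective v _ _) xa ya xb yb)
    }

  -- A common neighbour a of x and y would close the 4-cycle v, x, a, y.
  neighbours-independent : ∀ {x y} → T (neighbours v G x) → T (neighbours v G y) →
                           ¬ T (linked (remove v G) x y)
  neighbours-independent vx vy xy with x≢y , a , xa , ya ← linked-elim (remove v G) xy =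
    Fin.punchInᵢ≢i v a
      (no-C4 (x≢y ∘ Fin.punchIn-injective v _ _) xa ya (symm vx) (symm vy))

  degree-remove : ∀ x → degree G (punchIn v x) ≤ suc (degree (remove v G) x)
  degree-remove x = ≤-trans (≤-reflexive (sum-remove {i = v} (𝟙 ∘ G (punchIn v x))))
                            (+-monoˡ-≤ _ (𝟙≤1 (G (punchIn v x) v)))

  card-neighbours : card (neighbours v G) ≤ degree G v
  card-neighbours = ≤-trans (m≤n+m _ (𝟙 (G v v)))
                            (≤-reflexive (sym (sum-remove {i = v} (𝟙 ∘ G v))))

  extends : ∀ {G′ D S} → (∀ x → degree G v ≤ degree G x) → pred (degree G v) ≡ D →
            G′ ≗₂ remove v G → S ≗ neighbours v G → Extends G′ D S
  extends {G′} {D} {S} min refl G′≗ S≗ =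
      C4Free-resp G′≗ C4Free-remove
    , (λ x → ≤-trans (≤-trans (pred-mono-≤ (min (punchIn v x))) (pred-mono-≤ (degree-remove x)))
                     (≤-reflexive (sum-cong-≗ λ y → cong 𝟙 (sym (G′≗ x y)))))
    , (λ {x} {y} Sx Sy xy → neighbours-independent (subst T (S≗ x) Sx) (subst T (S≗ y) Sy)
         (let x≢y , a , xa , ya = linked-elim G′ xy in
          linked-intro (remove v G) x≢y (subst T (G′≗ x a) xa) (subst T (G′≗ y a) ya)))
    , ≤-trans (≤-reflexive (sum-cong-≗ λ y → cong 𝟙 (S≗ y))) (≤-trans card-neighbours (n≤suc-pred _))
    where
    n≤suc-pred : ∀ n → n ≤ suc (pred n)
    n≤suc-pred zero    = z≤n
    n≤suc-pred (suc n) = ≤-refl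

module _ (w : ℕ) where
  open Scale w

  -- A graph is recorded by the vertex v, the number D, the graph left after deleting v, and the
  -- neighbourhood of v. The first two cost at most 2^(8s) each and the last 2^(134s), so every
  -- vertex costs 2^(150s).
  cover-C4Free : ∀ m → m < 2 ^ (8 * w) → Cover _≗₂_ (C4Free {m}) ((2 ^ (150 * s)) ^ m)
  cover-C4Free zero    _   = cover-singleton (λ ()) (λ _ ())
  cover-C4Free (suc m) m<  =
    cover-≤ count
      (cover-bind {Q = At} (λ {G} free → let v , min = argmin (degree G) in
                    v , tt , λ { refl → free , min })
        (cover-Fin (suc m)) λ v →
       cover-bind {Q = λ D G → At v G × pred (degree G v) ≡ toℕ D}
                  (λ {G} (free , min) → degreeIndex G v , tt , λ { refl → (free , min) , sym (Fin.toℕ-fromℕ< _) })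
        (cover-Fin (suc m)) λ D →
       cover-bind {Q = λ G′ G → (At v G × pred (degree G v) ≡ toℕ D) × G′ ≗₂ remove v G}
                  (λ {G} at@((free , min) , _) → remove v G , C4Free-remove free v , λ eq → at , eq)
        (cover-C4Free m (<⇒≤ m<)) λ G′ →
       cover-map (extend v G′)
                  (λ {G} (((free , min) , deg) , G′≗) → neighbours v G
                       , extends free v min deg G′≗ (λ _ → refl)
                       , extend-remove free v G′≗)
        (cover-extensions (<⇒≤ m<) G′ (toℕ D) (≤-pred (Fin.toℕ<n D))))
    where
    At : Fin (suc m) → Graph (suc m) → Set
    At v G = C4Free G × ∀ x → degree G v ≤ degree G x

    degreeIndex : (G : Graph (suc m)) → Fin (suc m) → Fin (suc m)
    degreeIndex G v = Fin.fromℕ< (s≤s (pred-mono-≤ (card-≤ (G v))))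

    open ≤-Reasoning
    open +-*-Solver

    m≤2^ : suc m ≤ 2 ^ (8 * s)
    m≤2^ = ≤-trans (<⇒≤ m<) (^-monoʳ-≤ 2 (*-monoʳ-≤ 8 w≤s))

    count : suc m * (suc m * ((2 ^ (150 * s)) ^ m * 2 ^ (134 * s))) ≤ (2 ^ (150 * s)) ^ suc m
    count = begin
      suc m * (suc m * (B * 2 ^ (134 * s)))
        ≤⟨ *-mono-≤ m≤2^ (*-monoˡ-≤ _ m≤2^) ⟩
      2 ^ (8 * s) * (2 ^ (8 * s) * (B * 2 ^ (134 * s)))
        ≡⟨ solve 3 (λ a b c → a :* (a :* (b :* c)) := a :* a :* c :* b) refl (2 ^ (8 * s)) B (2 ^ (134 * s)) ⟩
      2 ^ (8 * s) * 2 ^ (8 * s) * 2 ^ (134 * s) * B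
        ≡⟨ cong (λ c → c * 2 ^ (134 * s) * B) (^-distribˡ-+-* 2 (8 * s) (8 * s)) ⟨
      2 ^ (8 * s + 8 * s) * 2 ^ (134 * s) * B
        ≡⟨ cong (_* B) (^-distribˡ-+-* 2 (8 * s + 8 * s) (134 * s)) ⟨
      2 ^ (8 * s + 8 * s + 134 * s) * B
        ≡⟨ cong (λ c → 2 ^ c * B) (solve 1 (λ s → con 8 :* s :+ con 8 :* s :+ con 134 :* s := con 150 :* s) refl s) ⟩
      2 ^ (150 * s) * B ∎
      where
      B : ℕ
      B = (2 ^ (150 * s)) ^ m

-- Hypergraphs of girth at least 5

infix 4 _≟ˢ_

_≟ˢ_ : (e f : Subset n) → Dec (e ≡ f)
_≟ˢ_ = ≡-dec Bool._≟_

allSubset? : {P : Subset n → Set} → (∀ e → Dec (P e)) → Dec (∀ e → P e)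
allSubset? P? = map′ (λ ¬∃ e → decidable-stable (P? e) λ ¬P → ¬∃ (e , ¬P))
                     (λ ∀P (e , ¬P) → ¬P (∀P e))
                     (¬? (anySubset? (¬? ∘ P?)))

anyVec? : (∀ {P : A → Set} → (∀ a → Dec (P a)) → Dec (∃ P)) →
          ∀ k {P : Vec A k → Set} → (∀ v → Dec (P v)) → Dec (∃ P)
anyVec? any zero    P? = map′ ([] ,_) (λ { ([] , P[]) → P[] }) (P? [])
anyVec? any (suc k) P? = map′ (λ (a , v , Pav) → a ∷ v , Pav) (λ { (a ∷ v , Pav) → a , v , Pav })
                              (any λ a → anyVec? any k λ v → P? (a ∷ v))

Injective : ∀ {k} → (Fin k → A) → Set
Injective f = ∀ i j → f i ≡ f j → i ≡ j

module _ (F : Multigraph) (H : Hypergraph n) where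
  open Multigraph F

  -- The subhypergraph is replaced by the labelled edges `f`, whose image it is. Short cycles can
  -- then be exhibited as vectors, and copies can be searched for.
  BergeCopy : (Fin order → Fin n) → (Fin size → Subset n) → Set
  BergeCopy φ f = Injective φ × Injective f × (∀ i → T (H (f i)))
                × (∀ i → φ (proj₁ (ends i)) ∈ f i × φ (proj₂ (ends i)) ∈ f i)

  BergeCopy⇒ContainsBerge : ∀ {φ f} → BergeCopy φ f → ContainsBerge F H
  BergeCopy⇒ContainsBerge {φ} {f} (φ-inj , f-inj , f∈H , inc) =
      H′
    , (λ e t → let i , fi≡e = preimage t in subst (T ∘ H) fi≡e (f∈H i))
    , mk↣ {to = φ} (φ-inj _ _)
    , mk⤖ {to = λ i → f i , fromWitness (i , refl)}
        ( f-inj _ _ ∘ cong proj₁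
        , λ (e , t) → let i , fi≡e = preimage t in
            i , λ { refl → edge-≡ fi≡e })
    , inc
    where
    H′ : Hypergraph n
    H′ e = ⌊ Fin.any? (λ i → f i ≟ˢ e) ⌋
    preimage : ∀ {e} → T (H′ e) → ∃[ i ] f i ≡ e
    preimage {e} = toWitness {a? = Fin.any? (λ i → f i ≟ˢ e)}
    edge-≡ : ∀ {e e′ t t′} → e ≡ e′ → (e , t) ≡ (Edge H′ ∋ (e′ , t′))
    edge-≡ {e} {t = t} {t′} refl = cong (e ,_) (Bool.T-irrelevant t t′)

  ContainsBerge⇒BergeCopy : ContainsBerge F H →
    ∃[ φ ] ∃[ f ] BergeCopy (Vec.lookup φ) (Vec.lookup f)
  ContainsBerge⇒BergeCopy (H′ , H′⊑H , φ , f , inc) =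
      tabulate (to φ) , tabulate f′
    , (λ i j eq → injective φ (trans (sym (φ≗ i)) (trans eq (φ≗ j))))
    , (λ i j eq → Bijection.injective f (edge-≡ (trans (sym (f≗ i)) (trans eq (f≗ j)))))
    , (λ i → subst (T ∘ H) (sym (f≗ i)) (H′⊑H _ (proj₂ (Bijection.to f i))))
    , λ i → subst₂ _∈_ (sym (φ≗ _)) (sym (f≗ i)) (proj₁ (inc i))
          , subst₂ _∈_ (sym (φ≗ _)) (sym (f≗ i)) (proj₂ (inc i))
    where
    open Injection using (to; injective)
    f′ : Fin size → Subset n
    f′ = proj₁ ∘ Bijection.to f
    φ≗ = lookup∘tabulate (to φ)
    f≗ = lookup∘tabulate f′
    edge-≡ : {x y : Edge H′} → proj₁ x ≡ proj₁ y → x ≡ y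
    edge-≡ {e , t} {_ , t′} refl = cong (e ,_) (Bool.T-irrelevant t t′)

  -- Deciding the girth condition is what allows an exact cardinality to be extracted from a cover.
  containsBerge? : Dec (ContainsBerge F H)
  containsBerge? = map′ (λ (_ , _ , copy) → BergeCopy⇒ContainsBerge copy) ContainsBerge⇒BergeCopy
    (anyVec? Fin.any? order λ φ → anyVec? anySubset? size λ f →
      injective? _≟_ (Vec.lookup φ) ×-dec injective? _≟ˢ_ (Vec.lookup f) ×-dec
      Fin.all? (λ i → T? (H (Vec.lookup f i))) ×-dec
      Fin.all? (λ i → (_ ∈? _) ×-dec (_ ∈? _)))
    where
    injective? : ∀ {B : Set} {k} → ((x y : B) → Dec (x ≡ y)) → (g : Fin k → B) → Dec (Injective g)
    injective? _≟′_ g = Fin.all? λ i → Fin.all? λ j → (g i ≟′ g j) →-dec (i ≟ j)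

module _ {H : Hypergraph n} (girth : Girth≥5 H) where

  linear : ∀ {x y e f} → x ≢ y → T (H e) → T (H f) →
           x ∈ e → y ∈ e → x ∈ f → y ∈ f → e ≡ f
  linear {x} {y} {e} {f} x≢y He Hf xe ye xf yf with e ≟ˢ f
  ... | yes eq = eq
  ... | no e≢f = contradiction
    (BergeCopy⇒ContainsBerge (cycle 2) H
      ( lookup-injective {xs = x ∷ y ∷ []} ((x≢y ∷ []) ∷ [] ∷ [])
      , lookup-injective {xs = e ∷ f ∷ []} ((e≢f ∷ []) ∷ [] ∷ [])
      , (λ { zero → He ; (suc zero) → Hf })
      , (λ { zero → xe , ye ; (suc zero) → yf , xf })))
    (proj₁ girth)

  no-triangle : ∀ {x y z e f g} → x ≢ y → x ≢ z → y ≢ z → e ≢ f → e ≢ g → f ≢ g →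
                T (H e) → T (H f) → T (H g) →
                x ∈ e × y ∈ e → y ∈ f × z ∈ f → z ∈ g × x ∈ g → ⊥
  no-triangle {x} {y} {z} {e} {f} {g} x≢y x≢z y≢z e≢f e≢g f≢g He Hf Hg ie if ig = proj₁ (proj₂ girth)
    (BergeCopy⇒ContainsBerge (cycle 3) H
      ( lookup-injective {xs = x ∷ y ∷ z ∷ []} ((x≢y ∷ x≢z ∷ []) ∷ (y≢z ∷ []) ∷ [] ∷ [])
      , lookup-injective {xs = e ∷ f ∷ g ∷ []} ((e≢f ∷ e≢g ∷ []) ∷ (f≢g ∷ []) ∷ [] ∷ [])
      , (λ { zero → He ; (suc zero) → Hf ; (suc (suc zero)) → Hg })
      , (λ { zero → ie ; (suc zero) → if ; (suc (suc zero)) → ig })))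

  no-square : ∀ {x y z u e f g h} →
              x ≢ y → x ≢ z → x ≢ u → y ≢ z → y ≢ u → z ≢ u →
              e ≢ f → e ≢ g → e ≢ h → f ≢ g → f ≢ h → g ≢ h →
              T (H e) → T (H f) → T (H g) → T (H h) →
              x ∈ e × y ∈ e → y ∈ f × z ∈ f → z ∈ g × u ∈ g → u ∈ h × x ∈ h → ⊥
  no-square {x} {y} {z} {u} {e} {f} {g} {h} xy xz xu yz yu zu ef eg eh fg fh gh He Hf Hg Hh ie if ig ih =
    proj₂ (proj₂ girth)
    (BergeCopy⇒ContainsBerge (cycle 4) H
      ( lookup-injective {xs = x ∷ y ∷ z ∷ u ∷ []}
          ((xy ∷ xz ∷ xu ∷ []) ∷ (yz ∷ yu ∷ []) ∷ (zu ∷ []) ∷ [] ∷ [])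
      , lookup-injective {xs = e ∷ f ∷ g ∷ h ∷ []}
          ((ef ∷ eg ∷ eh ∷ []) ∷ (fg ∷ fh ∷ []) ∷ (gh ∷ []) ∷ [] ∷ [])
      , (λ { zero → He ; (suc zero) → Hf ; (suc (suc zero)) → Hg ; (suc (suc (suc zero))) → Hh })
      , (λ { zero → ie ; (suc zero) → if ; (suc (suc zero)) → ig ; (suc (suc (suc zero))) → ih })))

-- Trace graphs and their decoding

-- The number of elements of the set below the given vertex, so positions start at 0.
rank : Subset n → Fin n → ℕ
rank (b ∷ e) zero    = 0
rank (b ∷ e) (suc x) = 𝟙 b + rank e x

∣∷∣ : ∀ b (e : Subset n) → ∣ b ∷ e ∣ ≡ 𝟙 b + ∣ e ∣
∣∷∣ true  e = refl
∣∷∣ false e = refl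

rank-< : {e : Subset n} {x : Fin n} → x ∈ e → rank e x < ∣ e ∣
rank-< {e = _ ∷ e} here       = s≤s z≤n
rank-< {e = b ∷ e} (there x∈) =
  ≤-trans (+-monoʳ-< (𝟙 b) (rank-< x∈)) (≤-reflexive (sym (∣∷∣ b e)))

rank-injective : {e : Subset n} {x y : Fin n} → x ∈ e → y ∈ e → rank e x ≡ rank e y → x ≡ y
rank-injective here here _ = refl
rank-injective {e = b ∷ e} (there x∈) (there y∈) eq =
  cong suc (rank-injective x∈ y∈ (+-cancelˡ-≡ (𝟙 b) _ _ eq))

element : {e : Subset n} → 1 ≤ ∣ e ∣ → ∃[ x ] x ∈ e
element {e = true  ∷ e} _  = zero , here
element {e = false ∷ e} 1≤ with x , x∈ ← element 1≤ = suc x , there x∈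

two-elements : {e : Subset n} → 2 ≤ ∣ e ∣ → ∃[ x ] ∃[ y ] x ∈ e × y ∈ e × x ≢ y
two-elements {e = true ∷ e} (s≤s 1≤) with y , y∈ ← element 1≤ = zero , suc y , here , there y∈ , λ ()
two-elements {e = false ∷ e} 2≤ with x , y , x∈ , y∈ , x≢y ← two-elements 2≤ =
  suc x , suc y , there x∈ , there y∈ , x≢y ∘ Fin.suc-injective

⊆∧∣∣≡⇒≡ : {e f : Subset n} → e ⊆ f → ∣ e ∣ ≡ ∣ f ∣ → e ≡ f
⊆∧∣∣≡⇒≡ {e = e} {f} e⊆f eq = ⊆-antisym e⊆f λ {x} x∈f →
  decidable-stable (x ∈? e) λ x∉e → <⇒≢ (p⊂q⇒∣p∣<∣q∣ (e⊆f , x , x∈f , x∉e)) eq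

Trace : ℕ → ℕ → Fin n → Fin n → Subset n → Set
Trace i j a b e = a ∈ e × b ∈ e × a ≢ b
                × ((rank e a ≡ i × rank e b ≡ j) ⊎ (rank e a ≡ j × rank e b ≡ i))

trace? : ∀ i j (a b : Fin n) e → Dec (Trace i j a b e)
trace? i j a b e = (a ∈? e) ×-dec (b ∈? e) ×-dec ¬? (a ≟ b) ×-dec
  (((rank e a ℕ.≟ i) ×-dec (rank e b ℕ.≟ j)) ⊎-dec ((rank e a ℕ.≟ j) ×-dec (rank e b ℕ.≟ i)))

-- Ranks identify the elements of `e`, so an edge of the hypergraph contributes at most one edge to
-- each trace graph.
trace-unique : ∀ {i j} {a b c d : Fin n} {e} → Trace i j a b e → Trace i j c d e →
               (a ≡ c × b ≡ d) ⊎ (a ≡ d × b ≡ c)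
trace-unique (a∈ , b∈ , _ , inj₁ (p , q)) (c∈ , d∈ , _ , inj₁ (p′ , q′)) =
  inj₁ (rank-injective a∈ c∈ (trans p (sym p′)) , rank-injective b∈ d∈ (trans q (sym q′)))
trace-unique (a∈ , b∈ , _ , inj₁ (p , q)) (c∈ , d∈ , _ , inj₂ (p′ , q′)) =
  inj₂ (rank-injective a∈ d∈ (trans p (sym q′)) , rank-injective b∈ c∈ (trans q (sym p′)))
trace-unique (a∈ , b∈ , _ , inj₂ (p , q)) (c∈ , d∈ , _ , inj₁ (p′ , q′)) =
  inj₂ (rank-injective a∈ d∈ (trans p (sym q′)) , rank-injective b∈ c∈ (trans q (sym p′)))
trace-unique (a∈ , b∈ , _ , inj₂ (p , q)) (c∈ , d∈ , _ , inj₂ (p′ , q′)) =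
  inj₁ (rank-injective a∈ c∈ (trans p (sym p′)) , rank-injective b∈ d∈ (trans q (sym q′)))

trace : Hypergraph n → ℕ → ℕ → Graph n
trace H i j a b = ⌊ anySubset? (λ e → T? (H e) ×-dec trace? i j a b e) ⌋

trace-C4Free : {H : Hypergraph n} → Girth≥5 H → ∀ i j → C4Free (trace H i j)
trace-C4Free {H = H} girth i j = record
  { symm   = λ t → case toWitness t of λ
      { (e , He , a∈ , b∈ , a≢b , ranks) → fromWitness
          (e , He , b∈ , a∈ , a≢b ∘ sym , [ (λ (p , q) → inj₂ (q , p)) , (λ (p , q) → inj₁ (q , p)) ]′ ranks) }
  ; irrefl = λ t → case toWitness t of λ { (_ , _ , _ , _ , a≢a , _) → a≢a refl }
  ; no-C4  = no-C4
  }
  where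
  no-C4 : ∀ {x y a b} → x ≢ y → T (trace H i j x a) → T (trace H i j y a) →
          T (trace H i j x b) → T (trace H i j y b) → a ≡ b
  no-C4 {x} {y} {a} {b} x≢y xa ya xb yb
    with e₁ , H₁ , t₁@(x∈₁ , a∈₁ , x≢a , _) ← toWitness xa
       | e₂ , H₂ , t₂@(y∈₂ , a∈₂ , y≢a , _) ← toWitness ya
       | e₃ , H₃ , t₃@(x∈₃ , b∈₃ , x≢b , _) ← toWitness xb
       | e₄ , H₄ , t₄@(y∈₄ , b∈₄ , y≢b , _) ← toWitness yb
    = decidable-stable (a ≟ b) λ a≢b →
      -- The cycle x, a, y, b runs through `e₁`, `e₂`, `e₄`, `e₃`. If two of these coincided,
      -- `trace-unique` would identify the corresponding sides of the cycle.
      no-square girth x≢a x≢y x≢b (y≢a ∘ sym) a≢b y≢b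
        (λ { refl → [ x≢y ∘ proj₁ , x≢a ∘ proj₁ ]′ (trace-unique t₁ t₂) })
        (λ { refl → [ x≢y ∘ proj₁ , x≢b ∘ proj₁ ]′ (trace-unique t₁ t₄) })
        (λ { refl → [ a≢b ∘ proj₂ , x≢b ∘ proj₁ ]′ (trace-unique t₁ t₃) })
        (λ { refl → [ a≢b ∘ proj₂ , y≢b ∘ proj₁ ]′ (trace-unique t₂ t₄) })
        (λ { refl → [ x≢y ∘ sym ∘ proj₁ , y≢b ∘ proj₁ ]′ (trace-unique t₂ t₃) })
        (λ { refl → [ x≢y ∘ sym ∘ proj₁ , y≢b ∘ proj₁ ]′ (trace-unique t₄ t₃) })
        H₁ H₂ H₄ H₃ (x∈₁ , a∈₁) (a∈₂ , y∈₂) (y∈₄ , b∈₄) (b∈₃ , x∈₃)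

module _ {r : ℕ} where

  Decodes : (Fin r → Fin r → Graph n) → Subset n → Set
  Decodes G e = ∣ e ∣ ≡ r × (∀ i j a b → Trace (toℕ i) (toℕ j) a b e → T (G i j a b))

  decodes? : (G : Fin r → Fin r → Graph n) → ∀ e → Dec (Decodes G e)
  decodes? G e = (∣ e ∣ ℕ.≟ r) ×-dec
    Fin.all? λ i → Fin.all? λ j → Fin.all? λ a → Fin.all? λ b →
      trace? (toℕ i) (toℕ j) a b e →-dec T? (G i j a b)

  decode : (Fin r → Fin r → Graph n) → Hypergraph n
  decode G e = ⌊ decodes? G e ⌋

  -- Two vertices a, b of a decoded set e lie in a common edge of H. For a third vertex z of
  -- e, the edges through ab, bz and za cannot be distinct, so z lies in the edge through ab.
  decode-trace : 2 ≤ r → {H : Hypergraph n} → Uniform r H → Girth≥5 H →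
                 {G : Fin r → Fin r → Graph n} → (∀ i j → G i j ≗₂ trace H (toℕ i) (toℕ j)) →
                 decode G ≗ H
  decode-trace 2≤r {H} uniform girth {G} G≗ e = T-ext (decoded⇒edge ∘ toWitness) λ He →
    fromWitness (uniform e He , λ i j a b tr → subst T (sym (G≗ i j a b)) (fromWitness (e , He , tr)))
    where
    decoded⇒edge : Decodes G e → T (H e)
    decoded⇒edge (refl , traces) with a , b , a∈e , b∈e , a≢b ← two-elements 2≤r = result
      where
      joint : ∀ {a b} → a ∈ e → b ∈ e → a ≢ b → ∃[ f ] T (H f) × a ∈ f × b ∈ f
      joint {a} {b} a∈ b∈ a≢b =
        case toWitness (subst T (G≗ _ _ a b) (traces (Fin.fromℕ< (rank-< a∈)) (Fin.fromℕ< (rank-< b∈)) a b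
               (a∈ , b∈ , a≢b , inj₁ (sym (Fin.toℕ-fromℕ< _) , sym (Fin.toℕ-fromℕ< _))))) of λ
          { (f , Hf , a∈f , b∈f , _) → f , Hf , a∈f , b∈f }
      result : T (H e)
      result with f , Hf , a∈f , b∈f ← joint a∈e b∈e a≢b =
        subst (T ∘ H) (sym (⊆∧∣∣≡⇒≡ e⊆f (sym (uniform f Hf)))) Hf
        where
        e⊆f : e ⊆ f
        e⊆f {z} z∈e with z ≟ a | z ≟ b
        ... | yes refl | _        = a∈f
        ... | no _     | yes refl = b∈f
        ... | no z≢a   | no z≢b
          with g , Hg , b∈g , z∈g ← joint b∈e z∈e (z≢b ∘ sym)
             | h , Hh , z∈h , a∈h ← joint z∈e a∈e z≢a
          = decidable-stable (z ∈? f) λ z∉f →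
            no-triangle girth a≢b (z≢a ∘ sym) (z≢b ∘ sym)
              (λ { refl → z∉f z∈g })
              (λ { refl → z∉f z∈h })
              -- If g = h, this edge contains both a and b, so linearity makes it f.
              (λ { refl → z∉f (subst (z ∈_) (linear girth a≢b Hg Hf a∈h b∈g a∈f b∈f) z∈g) })
              Hf Hg Hh (a∈f , b∈f) (b∈g , z∈g) (z∈h , a∈h)

-- Cardinalities

module _ (S : Setoid 0ℓ 0ℓ) where
  open Setoid S renaming (Carrier to X; refl to ≈-refl; sym to ≈-sym; trans to ≈-trans)

  cover⇒cardinality : (∀ x y → Dec (x ≈ y)) → Cover _≈_ (λ _ → ⊤) b → ∃[ N ] HasCardinality S N × N ≤ b
  cover⇒cardinality _≈?_ K = length xs
    , record
        { to        = lookup xs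
        ; cong      = λ { refl → ≈-refl }
        ; bijective = lookup-inj (UniqueDec.deduplicate-! decSetoid (elements K))
                    , λ y → let y∈ = covered y in Any.index y∈ , λ { refl → Any.lookup-index y∈ }
        }
    , ≤-trans (length-deduplicate _≈?_ (elements K)) (bound K)
    where
    decSetoid : DecSetoid 0ℓ 0ℓ
    decSetoid = record { isDecEquivalence = record { isEquivalence = isEquivalence ; _≟_ = _≈?_ } }
    xs : List X
    xs = deduplicate _≈?_ (elements K)
    covered : ∀ y → Any (_≈ y) xs
    covered y = Any.deduplicate⁺ _≈?_ (λ x≈z z≈y → ≈-trans x≈z z≈y) (covers K {y} tt)
    lookup-inj : ∀ {ys} → AllPairs (λ x y → ¬ x ≈ y) ys → ∀ {i j} → lookup ys i ≈ lookup ys j → i ≡ j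
    lookup-inj (_ ∷ _)  {zero}  {zero}  _  = refl
    lookup-inj (p ∷ _)  {zero}  {suc j} eq = contradiction eq (All.lookup p (∈-lookup j))
    lookup-inj (p ∷ _)  {suc i} {zero}  eq = contradiction (≈-sym eq) (All.lookup p (∈-lookup i))
    lookup-inj (_ ∷ ps) {suc i} {suc j} eq = cong suc (lookup-inj ps eq)

-- Dropping the listed elements outside `P` keeps a cover, since `resp` carries `P` from an element
-- to its listed representative.
cover-Σ : {_≈_ : A → A → Set} {P : A → Set} → (∀ a → Dec (P a)) → (∀ {a a′} → a′ ≈ a → P a → P a′) →
          Cover _≈_ P b → Cover {Σ[ a ∈ A ] P a} (λ x y → proj₁ x ≈ proj₁ y) (λ _ → ⊤) b
cover-Σ {A = A} {_≈_ = _≈_} {P} P? resp K = record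
  { elements = select (elements K)
  ; bound    = ≤-trans (length-select (elements K)) (bound K)
  ; covers   = λ { {a , Pa} _ → any-select Pa (covers K Pa) }
  }
  where
  select : List A → List (Σ[ a ∈ A ] P a)
  select []       = []
  select (a ∷ as) with P? a
  ... | yes Pa = (a , Pa) ∷ select as
  ... | no  _  = select as
  length-select : ∀ as → length (select as) ≤ length as
  length-select []       = z≤n
  length-select (a ∷ as) with P? a
  ... | yes _ = s≤s (length-select as)
  ... | no  _ = m≤n⇒m≤1+n (length-select as)
  any-select : ∀ {a as} → P a → Any (_≈ a) as → Any (λ x → proj₁ x ≈ a) (select as)
  any-select {as = a′ ∷ _} Pa (here a′≈a) with P? a′
  ... | yes _   = here a′≈a
  ... | no ¬Pa′ = contradiction (resp a′≈a Pa) ¬Pa′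
  any-select {as = a′ ∷ _} Pa (there a∈) with P? a′
  ... | yes _ = there (any-select Pa a∈)
  ... | no  _ = any-select Pa a∈

-- Enumerating the hypergraphs and choosing the constant

Good : ℕ → Hypergraph n → Set
Good r H = Uniform r H × Girth≥5 H

good? : ∀ r (H : Hypergraph n) → Dec (Good r H)
good? r H = allSubset? (λ e → T? (H e) →-dec (∣ e ∣ ℕ.≟ r))
      ×-dec ¬? (containsBerge? (cycle 2) H)
      ×-dec ¬? (containsBerge? (cycle 3) H)
      ×-dec ¬? (containsBerge? (cycle 4) H)

Good-resp : ∀ {r} {H H′ : Hypergraph n} → H′ ≗ H → Good r H → Good r H′
Good-resp {H = H} {H′} H′≗H (uniform , no₂ , no₃ , no₄) =
    (λ e → uniform e ∘ subst T (H′≗H e))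
  , no₂ ∘ transfer (cycle 2) , no₃ ∘ transfer (cycle 3) , no₄ ∘ transfer (cycle 4)
  where
  transfer : ∀ F → ContainsBerge F H′ → ContainsBerge F H
  transfer F (H″ , H″⊑H′ , berge) = H″ , (λ e → subst T (H′≗H e) ∘ H″⊑H′ e) , berge

cover-Good : ∀ {r} w → 2 ≤ r → n < 2 ^ (8 * w) →
             Cover _≗_ (Good {n} r) ((((2 ^ (150 * Scale.s w)) ^ n) ^ r) ^ r)
cover-Good {n} {r} w 2≤r n< = cover-map decode
  (λ {H} (uniform , girth) → (λ i j → trace H (toℕ i) (toℕ j))
    , (λ i j → trace-C4Free girth (toℕ i) (toℕ j))
    , decode-trace 2≤r uniform girth)
  (cover-family r (cover-family r (cover-C4Free w n n<)))

-- In the induction w is raised only when 2^(8w) has been reached by n + 2, so the overshoot is at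
-- most one factor 256.
scale : ∀ n → ∃[ w ] suc n < 2 ^ (8 * w) × 2 ^ (8 * w) ≤ 256 * suc n
scale zero = 1 , s≤s (s≤s z≤n) , ≤-refl
scale (suc n) with w , n< , ≤n ← scale n with suc (suc n) <? 2 ^ (8 * w)
... | yes n<′ = w , n<′ , ≤-trans ≤n (*-monoʳ-≤ 256 (n≤1+n (suc n)))
... | no  n≮  = suc w , subst (suc (suc n) <_) (sym 2^≡) larger
                      , ≤-trans (≤-reflexive 2^≡) (*-monoʳ-≤ 256 (≮⇒≥ n≮))
  where
  2^≡ : 2 ^ (8 * suc w) ≡ 256 * 2 ^ (8 * w)
  2^≡ = trans (cong (2 ^_) (*-suc 8 w)) (^-distribˡ-+-* 2 8 (8 * w))
  larger : suc (suc n) < 256 * 2 ^ (8 * w)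
  larger = ≤-<-trans n< (subst (2 ^ (8 * w) <_) (*-comm (2 ^ (8 * w)) 256)
    (m<m*n (2 ^ (8 * w)) 256 {{m^n≢0 2 (8 * w)}} (s≤s (s≤s z≤n))))

-- For n ≥ 1 this is s² ≤ 256 n; the factor n² lets it hold for n = 0 as well and matches the square
-- of the exponent s n.
scale-bound : ∀ n → ∃[ w ] n < 2 ^ (8 * w) × 2 ^ (8 * w) * n ^ 2 ≤ 256 * n ^ 3
scale-bound zero    = 0 , s≤s z≤n , z≤n
scale-bound (suc n) with w , n< , ≤n ← scale n =
  w , n< , ≤-trans (*-monoˡ-≤ (suc n ^ 2) ≤n) (≤-reflexive (*-assoc 256 (suc n) (suc n ^ 2)))

^2-cancel-≤ : ∀ a b → a ^ 2 ≤ b ^ 2 → a ≤ b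
^2-cancel-≤ a b a²≤b² with a ≤? b
... | yes a≤b = a≤b
... | no  a≰b = contradiction (^-monoˡ-< 2 (≰⇒> a≰b)) (≤⇒≯ a²≤b²)

theorem1p8 : ∀ (r : ℕ) → 2 ≤ r → ∃[ c ] ∀ (n : ℕ) → ∃[ N ] HasCardinality (Girth≥5Hypergraphs r n) N × N ≤2^[ c · n ^3/2]
-- There are r² trace graphs, each costing 2^(150 s n), and s ≤ 16 √n for n ≥ 1; 2400 = 150 · 16.
theorem1p8 r 2≤r = 2400 * (r * r) , λ n →
  let w , n< , s²n²≤ = scale-bound n
      N , card , N≤  = cover⇒cardinality (Girth≥5Hypergraphs r n)
                         (λ (H , _) (H′ , _) → allSubset? λ e → H e Bool.≟ H′ e)
                         (cover-Σ (good? r) Good-resp (cover-Good w 2≤r n<))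
  in N , card , λ p q c²n³q²≤p² → bound-root n w p q s²n²≤ N≤ c²n³q²≤p²
  where
  open ≤-Reasoning
  open +-*-Solver
  bound-root : ∀ n w p q {N} → 2 ^ (8 * w) * n ^ 2 ≤ 256 * n ^ 3 →
               N ≤ (((2 ^ (150 * Scale.s w)) ^ n) ^ r) ^ r →
               (2400 * (r * r)) ^ 2 * n ^ 3 * q ^ 2 ≤ p ^ 2 → N ^ q ≤ 2 ^ p
  bound-root n w p q {N} s²n²≤ N≤ c²n³q²≤p² = begin
    N ^ q                                    ≤⟨ ^-monoˡ-≤ q N≤ ⟩
    ((((2 ^ (150 * s)) ^ n) ^ r) ^ r) ^ q      ≡⟨ cong (_^ q) exponents ⟩
    (2 ^ (150 * s * n * r * r)) ^ q          ≡⟨ ^-*-assoc 2 (150 * s * n * r * r) q ⟩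
    2 ^ E                                    ≤⟨ ^-monoʳ-≤ 2 (^2-cancel-≤ E p E²≤p²) ⟩
    2 ^ p                                    ∎
    where
    open Scale w using (s; s*s≡)
    E : ℕ
    E = 150 * s * n * r * r * q
    exponents : (((2 ^ (150 * s)) ^ n) ^ r) ^ r ≡ 2 ^ (150 * s * n * r * r)
    exponents = trans (cong (λ x → (x ^ r) ^ r) (^-*-assoc 2 (150 * s) n))
      (trans (cong (_^ r) (^-*-assoc 2 (150 * s * n) r)) (^-*-assoc 2 (150 * s * n * r) r))
    -- After squaring, s occurs only through s² = 2^(8w), so no square root of n has to be formed.
    E²≤p² : E ^ 2 ≤ p ^ 2
    E²≤p² = begin
      E ^ 2
        ≡⟨ solve 5 (λ k s n r q → (k :* s :* n :* r :* r :* q) :^ 2 := s :* s :* n :^ 2 :* ((k :* (r :* r)) :^ 2 :* q :^ 2)) refl 150 s n r q ⟩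
      s * s * n ^ 2 * ((150 * (r * r)) ^ 2 * q ^ 2)
        ≡⟨ cong (λ x → x * n ^ 2 * ((150 * (r * r)) ^ 2 * q ^ 2)) s*s≡ ⟩
      2 ^ (8 * w) * n ^ 2 * ((150 * (r * r)) ^ 2 * q ^ 2)
        ≤⟨ *-monoˡ-≤ _ s²n²≤ ⟩
      256 * n ^ 3 * ((150 * (r * r)) ^ 2 * q ^ 2)
        ≡⟨ solve 4 (λ k r m q → k :* k :* m :* ((con 150 :* (r :* r)) :^ 2 :* q) := (k :* con 150 :* (r :* r)) :^ 2 :* m :* q) refl 16 r (n ^ 3) (q ^ 2) ⟩
      (2400 * (r * r)) ^ 2 * n ^ 3 * q ^ 2
        ≤⟨ c²n³q²≤p² ⟩
      p ^ 2 ∎
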